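{- There exists a bipartite graph $G$ with $n$ vertices in each vertex class and average degree at least $\frac{1}{8}\log\log n$ which is a $\frac{1}{20}$-multitasker. That is, for any integer $k=1,\dots,n$, any matching of size $k$ in $G$ contains an induced matching of size at least $k/20$.
   Context: A matching in a graph $G$ is a set of edges no two of which share a common vertex. A matching $M'$ in $G$ is induced if there are no two distinct edges of $M'$ that are connected by an edge of $G$. A bipartite graph $G$ with $n$ vertices in each vertex class is called an $\alpha$-multitasker, for $\alpha\in(0,1]$, if for every $k=1,\dots,n$ and every matching $M$ in $G$ of size $k$ there exists an induced matching $M'\subseteq M$ of $G$ with $|M'|\ge\alpha|M|$. -}

module Defs where

import Algebra.Definitions.RawSemiring as RawSemiring
open import Data.Fin.Base using (Fin)
open import Data.Fin.Subset using (Subset; _∈_; _⊆_; ∣_∣)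
open import Data.Integer.Base using (ℤ; +_; -[1+_])
open import Data.Nat.Base as ℕ using (ℕ; suc; NonZero)
open import Data.Nat.Properties using (m*n≢0; m^n≢0)
open import Data.Product.Base using (Σ-syntax; ∃-syntax; _×_; _,_)
open import Data.Rational.Unnormalised.Base
  using (ℚᵘ; ↥_; ↧ₙ_; 0ℚᵘ; 1ℚᵘ; _/_; _≤_; _<_; _*_; +-*-rawSemiring)
open import Data.Sum.Base using (_⊎_)
open import Data.Vec.Base using (lookup; tabulate)
open import Relation.Binary.PropositionalEquality using (_≡_; _≢_)
open import Relation.Nullary using (¬_)

open RawSemiring ℕ.+-*-rawSemiring using (sum)
open RawSemiring +-*-rawSemiring using (_^_)

-- A set of pairs (a , b), with a in the left class and b in the right class
-- (both Fin n), stored as the set of all right ends b for each left end a.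
EdgeSet : ℕ → Set
EdgeSet n = Fin n → Subset n

BipartiteGraph : ℕ → Set
BipartiteGraph = EdgeSet

Pair : ℕ → Set
Pair n = Fin n × Fin n

infix 4 _∈ᴱ_ _⊆ᴱ_

_∈ᴱ_ : ∀ {n} → Pair n → EdgeSet n → Set
(a , b) ∈ᴱ E = b ∈ E a

_⊆ᴱ_ : ∀ {n} → EdgeSet n → EdgeSet n → Set
E ⊆ᴱ F = ∀ a → E a ⊆ F a

size : ∀ {n} → EdgeSet n → ℕ
size E = sum (λ a → ∣ E a ∣)

leftDegree rightDegree : ∀ {n} → BipartiteGraph n → Fin n → ℕ
leftDegree  G a = ∣ G a ∣
rightDegree G b = ∣ tabulate (λ a → lookup (G a) b) ∣

averageDegree : ∀ {n} .{{_ : NonZero n}} → BipartiteGraph n → ℚᵘ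
averageDegree {n} G =
  (+ (sum (leftDegree G) ℕ.+ sum (rightDegree G))) / (2 ℕ.* n)
  where instance _ = m*n≢0 2 n

ShareVertex : ∀ {n} → Pair n → Pair n → Set
ShareVertex (a , b) (a′ , b′) = a ≡ a′ ⊎ b ≡ b′

-- Meant for two edges without a common vertex, as in a matching.
Connected : ∀ {n} → BipartiteGraph n → Pair n → Pair n → Set
Connected G (a , b) (a′ , b′) = (a , b′) ∈ᴱ G ⊎ (a′ , b) ∈ᴱ G

IsMatching : ∀ {n} → BipartiteGraph n → EdgeSet n → Set
IsMatching G M =
  M ⊆ᴱ G × (∀ e f → e ∈ᴱ M → f ∈ᴱ M → e ≢ f → ¬ ShareVertex e f)

IsInducedMatching : ∀ {n} → BipartiteGraph n → EdgeSet n → Set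
IsInducedMatching G M =
  IsMatching G M × (∀ e f → e ∈ᴱ M → f ∈ᴱ M → e ≢ f → ¬ Connected G e f)

record IsMultitasker {n : ℕ} (α : ℚᵘ) (G : BipartiteGraph n) : Set where
  field
    0<α : 0ℚᵘ < α
    α≤1 : α ≤ 1ℚᵘ
    induced : ∀ k → 1 ℕ.≤ k → k ℕ.≤ n →
              ∀ M → IsMatching G M → size M ≡ k →
              Σ[ M′ ∈ EdgeSet n ]
                M′ ⊆ᴱ M × IsInducedMatching G M′ ×
                α * ((+ size M) / 1) ≤ (+ size M′) / 1

-- Lower cut of rationals (there are no reals in the library):
-- X q means "q < x", where x is the extended real number represented by X.
Cut : Set₁
Cut = ℚᵘ → Set

natural : ℕ → Cut
natural m q = q < (+ m) / 1

2^_ : ℤ → ℚᵘ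
2^ (+ m)    = (+ (2 ℕ.^ m)) / 1
2^ -[1+ m ] = (+ 1) / (2 ℕ.^ suc m)
  where instance _ = m^n≢0 2 (suc m)

-- For s > 0 and q = a / b with b > 0:  2 ^ q < s  iff  2 ^ a < s ^ b.
Exp₂< : ℚᵘ → ℚᵘ → Set
Exp₂< q s = 0ℚᵘ < s × 2^ (↥ q) < s ^ (↧ₙ q)

-- q < log₂ x  iff  2 ^ q < x  iff  2 ^ q < s < x for some rational s.
log₂ : Cut → Cut
log₂ X q = ∃[ s ] X s × Exp₂< q s

-- c · x; meaningful for c > 0 only.
infixr 7 _·_
_·_ : ℚᵘ → Cut → Cut
(c · X) q = ∃[ r ] X r × q ≤ c * r

-- x ≤ p, i.e. every rational q < x satisfies q ≤ p.
infix 4 _≤ᶜ_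
_≤ᶜ_ : Cut → ℚᵘ → Set
X ≤ᶜ p = ∀ q → X q → q ≤ p

{-# OPTIONS --safe #-}
module Submission where

import Algebra.Definitions.RawSemiring as RawSemiring
open import Data.Bool.Base using (Bool; true; false; _∧_; _∨_; if_then_else_; T)
open import Data.Bool.ListAction using (any)
open import Data.Fin.Base using (Fin; zero; suc; toℕ; fromℕ<)
open import Data.Fin.Properties using (_≟_; any?; toℕ-injective; toℕ<n; toℕ-fromℕ<)
open import Data.Fin.Subset as Subset using (Subset; ∣_∣; ⁅_⁆; inside; outside)
open import Data.Fin.Subset.Properties
  using (nonempty?; ∣⊥∣≡0; ∣⁅x⁆∣≡1; x∈⁅x⁆; x∈⁅y⁆⇒x≡y; ∉⊥; p⊆q⇒∣p∣≤∣q∣)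
open import Data.Integer.Base as ℤ using (-[1+_]; -≤+; +≤+)
import Data.Integer.Properties as ℤ
open import Data.List.Base as List
  using (List; []; _∷_; _++_; map; length; applyUpTo; downFrom; take; drop; allFin;
         cartesianProductWith; concatMap; filter)
open import Data.List.Membership.Propositional using (_∈_; find; lose)
open import Data.List.Membership.Propositional.Properties
  using (∈-allFin; ∈-map⁺; ∈-map⁻; ∈-++⁺ˡ; ∈-++⁺ʳ; ∈-filter⁺; ∈-filter⁻; ∈-concatMap⁺; ∈-concatMap⁻;
         ∈-applyUpTo⁻; ∈-downFrom⁺; ∈-downFrom⁻; ∈-cartesianProductWith⁻)
open import Data.List.Properties
  using (length-++; length-map; length-applyUpTo; length-tabulate; take++drop≡id)
open import Data.List.Relation.Binary.Pointwise as Pointwise using (Pointwise; []; _∷_)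
open import Data.List.Relation.Unary.All as All using (All; []; _∷_)
import Data.List.Relation.Unary.All.Properties as All
open import Data.List.Relation.Unary.AllPairs using (AllPairs; []; _∷_)
import Data.List.Relation.Unary.AllPairs.Properties as AllPairs
open import Data.List.Relation.Unary.Any using (here; there)
open import Data.Nat.Base hiding (_/_)
import Data.Nat.DivMod as ℕ
open import Data.Nat.ListAction using (sum)
open import Data.Nat.Properties hiding (_≟_)
open import Data.Nat.Tactic.RingSolver using (solve-∀)
open import Data.Product.Base using (Σ-syntax; ∃-syntax; _×_; _,_; proj₁; proj₂)
open import Data.Rational.Unnormalised.Base as ℚ using (ℚᵘ; mkℚᵘ; 0ℚᵘ; _/_; *≤*; *<*)
import Data.Rational.Unnormalised.Properties as ℚ
open import Data.Sum.Base using (_⊎_; inj₁; inj₂; [_,_])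
open import Data.Vec.Base using (Vec; []; _∷_; lookup; tabulate)
open import Data.Vec.Properties using (lookup∘tabulate; []=⇒lookup)
import Data.Vec.Relation.Unary.All as VecAll
import Data.Vec.Relation.Unary.All.Properties as VecAll
open import Function.Base using (_∘_)
open import Relation.Binary.PropositionalEquality hiding ([_])
open import Relation.Nullary using (yes; no; does; contradiction; ¬_)
open import Relation.Unary using (Decidable)
open import Defs

open RawSemiring +-*-rawSemiring using () renaming (sum to sumᶠ)
open RawSemiring ℚ.+-*-rawSemiring using () renaming (_^_ to _^ℚ_)

-- Fix p with n ≤ 2 ^ p < 2 n.  Every left vertex chooses one neighbour in each
-- of t levels [2 ^ r , 2 ^ suc r) of the right class, where r = p ∸ 16 ^ suc i for
-- i < t and log log n ≤ 8 t, so that the level sizes shrink doubly exponentially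
-- (as in the graphs of Pyber, Rödl and Szemerédi without 3-regular subgraphs; for
-- t ≤ 1 a perfect matching does).  Consider m left and m right vertices and choose
-- q with m ≤ 2 ^ (p ∸ q) < 2 m.  In the levels with 2 · 16 ^ suc i ≤ q a union
-- bound, derandomised by conditional expectations, leaves at most 7 m edges; the
-- next level adds at most m, since a left vertex has one neighbour per level; all
-- later levels lie below 2 ^ (p ∸ q) / 16 < m / 8.  A matching M of size m loses at
-- most m / 8 edges when those ending below that bound are removed, and contracting
-- the others gives a graph all of whose subgraphs have average total degree at most
-- 16.  A greedy independent set in it is an induced matching of size at least
-- (7/8) m / 16 ≥ m / 20.

private
  variable
    A B C X : Set
    n : ℕ

-- Sums and conditional expectations

∑ : List A → (A → ℕ) → ℕ
∑ xs f = sum (map f xs)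

∑-cong : (xs : List A) {f g : A → ℕ} → (∀ x → f x ≡ g x) → ∑ xs f ≡ ∑ xs g
∑-cong []       eq = refl
∑-cong (x ∷ xs) eq = cong₂ _+_ (eq x) (∑-cong xs eq)

∑-mono-∈ : (xs : List A) {f g : A → ℕ} → (∀ {x} → x ∈ xs → f x ≤ g x) → ∑ xs f ≤ ∑ xs g
∑-mono-∈ []       le = z≤n
∑-mono-∈ (x ∷ xs) le = +-mono-≤ (le (here refl)) (∑-mono-∈ xs (le ∘ there))

∑-mono : (xs : List A) {f g : A → ℕ} → (∀ x → f x ≤ g x) → ∑ xs f ≤ ∑ xs g
∑-mono xs le = ∑-mono-∈ xs (λ {x} _ → le x)

∑-*ˡ : (xs : List A) (c : ℕ) (f : A → ℕ) → ∑ xs (λ x → c * f x) ≡ c * ∑ xs f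
∑-*ˡ []       c f = sym (*-zeroʳ c)
∑-*ˡ (x ∷ xs) c f = trans (cong (c * f x +_) (∑-*ˡ xs c f)) (sym (*-distribˡ-+ c (f x) _))

∑-*ʳ : (xs : List A) (c : ℕ) (f : A → ℕ) → ∑ xs (λ x → f x * c) ≡ ∑ xs f * c
∑-*ʳ []       c f = refl
∑-*ʳ (x ∷ xs) c f = trans (cong (f x * c +_) (∑-*ʳ xs c f)) (sym (*-distribʳ-+ c (f x) _))

∑-+ : (xs : List A) (f g : A → ℕ) → ∑ xs (λ x → f x + g x) ≡ ∑ xs f + ∑ xs g
∑-+ []       f g = refl
∑-+ (x ∷ xs) f g = trans (cong (f x + g x +_) (∑-+ xs f g)) (interchange (f x) (g x) _ _)
  where
  interchange : ∀ a b c d → a + b + (c + d) ≡ a + c + (b + d)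
  interchange = solve-∀

∑-const : (xs : List A) (c : ℕ) → ∑ xs (λ _ → c) ≡ length xs * c
∑-const []       c = refl
∑-const (x ∷ xs) c = cong (c +_) (∑-const xs c)

∑-zero : (xs : List A) → ∑ xs (λ _ → 0) ≡ 0
∑-zero xs = trans (∑-const xs 0) (*-zeroʳ (length xs))

∑-swap : (xs : List A) (ys : List B) (f : A → B → ℕ) →
         ∑ xs (λ x → ∑ ys (f x)) ≡ ∑ ys (λ y → ∑ xs (λ x → f x y))
∑-swap []       ys f = sym (∑-zero ys)
∑-swap (x ∷ xs) ys f =
  trans (cong (∑ ys (f x) +_) (∑-swap xs ys f)) (sym (∑-+ ys (f x) _))

∑-++ : (xs ys : List A) (f : A → ℕ) → ∑ (xs ++ ys) f ≡ ∑ xs f + ∑ ys f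
∑-++ []       ys f = refl
∑-++ (x ∷ xs) ys f = trans (cong (f x +_) (∑-++ xs ys f)) (sym (+-assoc (f x) _ _))

∑-map : (h : A → B) (xs : List A) (f : B → ℕ) → ∑ (map h xs) f ≡ ∑ xs (f ∘ h)
∑-map h []       f = refl
∑-map h (x ∷ xs) f = cong (f (h x) +_) (∑-map h xs f)

∑-concatMap : (h : A → List B) (xs : List A) (f : B → ℕ) →
              ∑ (concatMap h xs) f ≡ ∑ xs (λ x → ∑ (h x) f)
∑-concatMap h []       f = refl
∑-concatMap h (x ∷ xs) f =
  trans (∑-++ (h x) (concatMap h xs) f) (cong (∑ (h x) f +_) (∑-concatMap h xs f))

∑-filter : {P : A → Set} (P? : Decidable P) (xs : List A) (f : A → ℕ) →
           ∑ (filter P? xs) f ≤ ∑ xs f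
∑-filter P? []       f = z≤n
∑-filter P? (x ∷ xs) f with P? x
... | yes _ = +-monoʳ-≤ (f x) (∑-filter P? xs f)
... | no  _ = ≤-trans (∑-filter P? xs f) (m≤n+m _ (f x))

∈⇒≤∑ : {x : A} {xs : List A} (f : A → ℕ) → x ∈ xs → f x ≤ ∑ xs f
∈⇒≤∑ f (here refl)         = m≤m+n _ _
∈⇒≤∑ f (there {x = y} x∈xs) = ≤-trans (∈⇒≤∑ f x∈xs) (m≤n+m _ (f y))

∑-cartesianProductWith : (h : A → B → C) (xs : List A) (ys : List B) (f : C → ℕ) →
  ∑ (cartesianProductWith h xs ys) f ≡ ∑ xs (λ x → ∑ ys (λ y → f (h x y)))
∑-cartesianProductWith h []       ys f = refl
∑-cartesianProductWith h (x ∷ xs) ys f =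
  trans (∑-++ (map (h x) ys) _ f)
        (cong₂ _+_ (∑-map (h x) ys f) (∑-cartesianProductWith h xs ys f))

length-cartesianProductWith : (h : A → B → C) (xs : List A) (ys : List B) →
  length (cartesianProductWith h xs ys) ≡ length xs * length ys
length-cartesianProductWith h []       ys = refl
length-cartesianProductWith h (x ∷ xs) ys =
  trans (length-++ (map (h x) ys))
        (cong₂ _+_ (length-map (h x) ys) (length-cartesianProductWith h xs ys))

-- Averaging: a head above `c` takes more than its share, so the tail still has mean at most `c`.
∑≤⇒∃≤ : (xs : List A) (f : A → ℕ) (c : ℕ) → 0 < length xs → ∑ xs f ≤ length xs * c →
        ∃[ x ] x ∈ xs × f x ≤ c
∑≤⇒∃≤ (x ∷ xs) f c _ le with f x ≤? c
... | yes fx≤c = x , here refl , fx≤c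
∑≤⇒∃≤ (x ∷ [])     f c _ le | no fx≰c with () ← fx≰c (subst₂ _≤_ (+-identityʳ _) (+-identityʳ _) le)
∑≤⇒∃≤ (x ∷ y ∷ xs) f c _ le | no fx≰c
  with z , z∈ , fz≤c ← ∑≤⇒∃≤ (y ∷ xs) f c z<s
         (+-cancelˡ-≤ c _ _ (≤-trans (+-monoˡ-≤ _ (≰⇒≥ fx≰c)) le))
  = z , there z∈ , fz≤c

∏ : (X → ℕ) → Vec X n → ℕ
∏ g []      = 1
∏ g (x ∷ v) = g x * ∏ g v

-- The method of conditional expectations: the weight w c is the product of
-- the factors already fixed, and G c stands for the mean of a free factor.
conditionalExpectations :
  (cs : List C) (xs : List X) → 0 < length xs → (g : C → X → ℕ) (G : C → ℕ) →
  (∀ {c} → c ∈ cs → ∑ xs (g c) ≤ length xs * G c) →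
  ∀ n (w : C → ℕ) →
  ∃[ v ] VecAll.All (_∈ xs) {n} v × ∑ cs (λ c → w c * ∏ (g c) v) ≤ ∑ cs (λ c → w c * G c ^ n)
conditionalExpectations cs xs ne g G mean zero w = [] , VecAll.[] , ≤-refl
conditionalExpectations {C = C} {X = X} cs xs ne g G mean (suc n) w =
  let x , x∈xs , le  = ∑≤⇒∃≤ xs F _ ne mean-F
      v , v∈xs , le′ = conditionalExpectations cs xs ne g G mean n (λ c → w c * g c x)
  in x ∷ v , x∈xs VecAll.∷ v∈xs , (begin
       ∑ cs (λ c → w c * (g c x * ∏ (g c) v)) ≡⟨ ∑-cong cs (λ c → sym (*-assoc (w c) (g c x) _)) ⟩
       ∑ cs (λ c → w c * g c x * ∏ (g c) v)   ≤⟨ le′ ⟩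
       F x                                    ≤⟨ le ⟩
       ∑ cs (λ c → w c * G c ^ suc n)         ∎)
  where
  open ≤-Reasoning
  -- The potential once the first entry is `x`: the `n` entries still free are replaced by their
  -- means.
  F : X → ℕ
  F x = ∑ cs (λ c → w c * g c x * G c ^ n)
  rearrange₁ : ∀ a b c → a * b * c ≡ a * c * b
  rearrange₁ = solve-∀
  rearrange₂ : ∀ a b c d → a * d * (b * c) ≡ b * (a * (c * d))
  rearrange₂ = solve-∀
  mean-F : ∑ xs F ≤ length xs * ∑ cs (λ c → w c * G c ^ suc n)
  mean-F = begin
    ∑ xs F
      ≡⟨ ∑-swap xs cs _ ⟩
    ∑ cs (λ c → ∑ xs (λ x → w c * g c x * G c ^ n))
      ≡⟨ ∑-cong cs (λ c → trans (∑-cong xs λ x → rearrange₁ (w c) (g c x) (G c ^ n))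
                                (∑-*ˡ xs (w c * G c ^ n) (g c))) ⟩
    ∑ cs (λ c → w c * G c ^ n * ∑ xs (g c))
      ≤⟨ ∑-mono-∈ cs (λ {c} c∈cs → *-monoʳ-≤ (w c * G c ^ n) (mean c∈cs)) ⟩
    ∑ cs (λ c → w c * G c ^ n * (length xs * G c))
      ≡⟨ ∑-cong cs (λ c → rearrange₂ (w c) (length xs) (G c) (G c ^ n)) ⟩
    ∑ cs (λ c → length xs * (w c * (G c * G c ^ n)))
      ≡⟨ ∑-*ˡ cs (length xs) _ ⟩
    length xs * ∑ cs (λ c → w c * G c ^ suc n) ∎

-- Subsets and level choices

𝟙 : Bool → ℕ
𝟙 true  = 1
𝟙 false = 0

𝟙≤1 : ∀ b → 𝟙 b ≤ 1
𝟙≤1 true  = ≤-refl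
𝟙≤1 false = z≤n

∣∷∣ : ∀ b (χ : Subset n) → ∣ b ∷ χ ∣ ≡ 𝟙 b + ∣ χ ∣
∣∷∣ true  χ = refl
∣∷∣ false χ = refl

subsets : ∀ n → List (Subset n)
subsets zero    = [] ∷ []
subsets (suc n) = map (inside ∷_) (subsets n) ++ map (outside ∷_) (subsets n)

∈-subsets : (χ : Subset n) → χ ∈ subsets n
∈-subsets []          = here refl
∈-subsets (true  ∷ χ) = ∈-++⁺ˡ (∈-map⁺ _ (∈-subsets χ))
∈-subsets (false ∷ χ) = ∈-++⁺ʳ (map _ (subsets _)) (∈-map⁺ _ (∈-subsets χ))

-- The monomial `a ^ ∣ χ ∣ * b ^ (n ∸ ∣ χ ∣)`, kept as a product over the entries so that the
-- binomial theorem `∑-weight` is an induction on `n`.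
weight : ℕ → ℕ → Subset n → ℕ
weight a b = ∏ (λ s → if s then a else b)

∑-weight : ∀ n a b → ∑ (subsets n) (weight a b) ≡ (a + b) ^ n
∑-weight zero    a b = refl
∑-weight (suc n) a b = begin
  ∑ (subsets (suc n)) (weight a b)
    ≡⟨ ∑-++ (map (inside ∷_) (subsets n)) _ _ ⟩
  ∑ (map (inside ∷_) (subsets n)) (weight a b) + ∑ (map (outside ∷_) (subsets n)) (weight a b)
    ≡⟨ cong₂ _+_ (trans (∑-map _ (subsets n) _) (∑-*ˡ (subsets n) a _))
                 (trans (∑-map _ (subsets n) _) (∑-*ˡ (subsets n) b _)) ⟩
  a * ∑ (subsets n) (weight a b) + b * ∑ (subsets n) (weight a b)
    ≡⟨ *-distribʳ-+ _ a b ⟨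
  (a + b) * ∑ (subsets n) (weight a b)
    ≡⟨ cong ((a + b) *_) (∑-weight n a b) ⟩
  (a + b) ^ suc n ∎
  where open ≡-Reasoning

-- The factor `2 ^ (p * ∣ χ ∣)` clears the exponent `n ∸ ∣ χ ∣` of the outside entries, so that no
-- subtraction occurs.
weight-2^ : ∀ κ p (χ : Subset n) →
            2 ^ (p * ∣ χ ∣) * weight (2 ^ κ) (2 ^ p) χ ≡ 2 ^ (p * n + κ * ∣ χ ∣)
weight-2^ κ p [] rewrite *-zeroʳ p | *-zeroʳ κ = refl
weight-2^ {n = suc n} κ p (true ∷ χ) = begin
  2 ^ (p * suc ∣ χ ∣) * (2 ^ κ * weight (2 ^ κ) (2 ^ p) χ)
    ≡⟨ cong (λ e → 2 ^ e * (2 ^ κ * weight (2 ^ κ) (2 ^ p) χ)) (*-suc p ∣ χ ∣) ⟩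
  2 ^ (p + p * ∣ χ ∣) * (2 ^ κ * weight (2 ^ κ) (2 ^ p) χ)
    ≡⟨ cong (_* (2 ^ κ * weight (2 ^ κ) (2 ^ p) χ)) (^-distribˡ-+-* 2 p (p * ∣ χ ∣)) ⟩
  2 ^ p * 2 ^ (p * ∣ χ ∣) * (2 ^ κ * weight (2 ^ κ) (2 ^ p) χ)
    ≡⟨ rearrange (2 ^ p) _ (2 ^ κ) _ ⟩
  2 ^ p * 2 ^ κ * (2 ^ (p * ∣ χ ∣) * weight (2 ^ κ) (2 ^ p) χ)
    ≡⟨ cong₂ _*_ (sym (^-distribˡ-+-* 2 p κ)) (weight-2^ κ p χ) ⟩
  2 ^ (p + κ) * 2 ^ (p * n + κ * ∣ χ ∣)
    ≡⟨ ^-distribˡ-+-* 2 (p + κ) _ ⟨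
  2 ^ (p + κ + (p * n + κ * ∣ χ ∣))
    ≡⟨ cong (2 ^_) (exponent p κ n ∣ χ ∣) ⟩
  2 ^ (p * suc n + κ * suc ∣ χ ∣) ∎
  where
  open ≡-Reasoning
  rearrange : ∀ a b c d → a * b * (c * d) ≡ a * c * (b * d)
  rearrange = solve-∀
  exponent : ∀ p κ n m → p + κ + (p * n + κ * m) ≡ p * suc n + κ * suc m
  exponent = solve-∀
weight-2^ {n = suc n} κ p (false ∷ χ) = begin
  2 ^ (p * ∣ χ ∣) * (2 ^ p * weight (2 ^ κ) (2 ^ p) χ)
    ≡⟨ rearrange (2 ^ (p * ∣ χ ∣)) (2 ^ p) _ ⟩
  2 ^ p * (2 ^ (p * ∣ χ ∣) * weight (2 ^ κ) (2 ^ p) χ)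
    ≡⟨ cong (2 ^ p *_) (weight-2^ κ p χ) ⟩
  2 ^ p * 2 ^ (p * n + κ * ∣ χ ∣)
    ≡⟨ ^-distribˡ-+-* 2 p _ ⟨
  2 ^ (p + (p * n + κ * ∣ χ ∣))
    ≡⟨ cong (2 ^_) (exponent p n (κ * ∣ χ ∣)) ⟩
  2 ^ (p * suc n + κ * ∣ χ ∣) ∎
  where
  open ≡-Reasoning
  rearrange : ∀ a b c → a * (b * c) ≡ b * (a * c)
  rearrange = solve-∀
  exponent : ∀ p n m → p + (p * n + m) ≡ p * suc n + m
  exponent = solve-∀

-- Extended by 0 beyond `n`, since levels consist of natural numbers that are shown to lie below `n`
-- only later.
at : Subset n → ℕ → ℕ
at []      y       = 0
at (b ∷ χ) zero    = 𝟙 b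
at (b ∷ χ) (suc y) = at χ y

at≤1 : (χ : Subset n) → ∀ y → at χ y ≤ 1
at≤1 []      y       = z≤n
at≤1 (b ∷ χ) zero    = 𝟙≤1 b
at≤1 (b ∷ χ) (suc y) = at≤1 χ y

∑-applyUpTo : (f : ℕ → A) (s : ℕ) (g : A → ℕ) → ∑ (applyUpTo f s) g ≡ sum (applyUpTo (g ∘ f) s)
∑-applyUpTo f zero    g = refl
∑-applyUpTo f (suc s) g = cong (g (f 0) +_) (∑-applyUpTo (f ∘ suc) s g)

sum-at≤∣∣ : (χ : Subset n) → ∀ o s → sum (applyUpTo (λ i → at χ (o + i)) s) ≤ ∣ χ ∣
sum-at≤∣∣ []      o       zero    = z≤n
sum-at≤∣∣ []      o       (suc s) = sum-at≤∣∣ [] o s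
sum-at≤∣∣ (b ∷ χ) zero    zero    = z≤n
sum-at≤∣∣ (b ∷ χ) zero    (suc s) = begin
  𝟙 b + sum (applyUpTo (at χ) s) ≤⟨ +-monoʳ-≤ (𝟙 b) (sum-at≤∣∣ χ 0 s) ⟩
  𝟙 b + ∣ χ ∣                    ≡⟨ ∣∷∣ b χ ⟨
  ∣ b ∷ χ ∣                      ∎
  where open ≤-Reasoning
sum-at≤∣∣ (b ∷ χ) (suc o) s = begin
  sum (applyUpTo (λ i → at χ (o + i)) s) ≤⟨ sum-at≤∣∣ χ o s ⟩
  ∣ χ ∣                                  ≤⟨ m≤n+m ∣ χ ∣ (𝟙 b) ⟩
  𝟙 b + ∣ χ ∣                            ≡⟨ ∣∷∣ b χ ⟨
  ∣ b ∷ χ ∣                              ∎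
  where open ≤-Reasoning

-- Dyadic levels and exponential moments

level : ℕ → List ℕ
level r = applyUpTo (2 ^ r +_) (2 ^ r)

_∈ᴸ_ : ℕ → ℕ → Set
y ∈ᴸ r = 2 ^ r ≤ y × y < 2 ^ suc r

∈-level⁻ : ∀ {r y} → y ∈ level r → y ∈ᴸ r
∈-level⁻ {r} y∈ with i , i<2^r , refl ← ∈-applyUpTo⁻ (2 ^ r +_) y∈ =
  m≤m+n _ i , (begin-strict
    2 ^ r + i           <⟨ +-monoʳ-< (2 ^ r) i<2^r ⟩
    2 ^ r + 2 ^ r       ≡⟨ cong (2 ^ r +_) (+-identityʳ _) ⟨
    2 ^ r + (2 ^ r + 0) ∎)
  where open ≤-Reasoning

choices : List ℕ → List (List ℕ)
choices []       = [] ∷ []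
choices (r ∷ rs) = cartesianProductWith _∷_ (level r) (choices rs)

∈-choices⁻ : ∀ rs {x} → x ∈ choices rs → Pointwise (λ r y → y ∈ᴸ r) rs x
∈-choices⁻ []       (here refl) = []
∈-choices⁻ (r ∷ rs) x∈
  with y , x , y∈ , x∈′ , refl ← ∈-cartesianProductWith⁻ _∷_ (level r) (choices rs) x∈
  = ∈-level⁻ {r} y∈ ∷ ∈-choices⁻ rs x∈′

length-choices-∷ : ∀ r rs → length (choices (r ∷ rs)) ≡ 2 ^ r * length (choices rs)
length-choices-∷ r rs =
  trans (length-cartesianProductWith _∷_ (level r) (choices rs))
        (cong (_* length (choices rs)) (length-applyUpTo (2 ^ r +_) (2 ^ r)))

0<length-choices : ∀ rs → 0 < length (choices rs)
0<length-choices []       = z<s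
0<length-choices (r ∷ rs) =
  subst (0 <_) (sym (length-choices-∷ r rs)) (*-mono-≤ (m^n>0 2 r) (0<length-choices rs))

deg : Subset n → ℕ → List ℕ → ℕ
deg χ j x = ∑ (take j x) (at χ)

-- Makes the exponential moment of a 0/1 variable linear, so that summing it over a level only
-- requires counting the elements of `χ` there.
2^*≤1+ : ∀ ℓ {d} → d ≤ 1 → 2 ^ (ℓ * d) ≤ 1 + 2 ^ ℓ * d
2^*≤1+ ℓ z≤n       rewrite *-zeroʳ ℓ = s≤s z≤n
2^*≤1+ ℓ (s≤s z≤n) rewrite *-identityʳ ℓ | *-identityʳ (2 ^ ℓ) = n≤1+n _

-- A uniform element of the level lies in `χ` with probability at most `2 ^ κ / 2 ^ r`, so a hit,
-- worth `2 ^ ℓ`, adds at most 1 to the mean.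
∑-level : (χ : Subset n) → ∀ κ ℓ r → ∣ χ ∣ ≤ 2 ^ κ → κ + ℓ ≤ r →
          ∑ (level r) (λ y → 2 ^ (ℓ * at χ y)) ≤ 2 ^ r * 2
∑-level χ κ ℓ r ∣χ∣≤2^κ κ+ℓ≤r = begin
  ∑ (level r) (λ y → 2 ^ (ℓ * at χ y))
    ≤⟨ ∑-mono (level r) (λ y → 2^*≤1+ ℓ (at≤1 χ y)) ⟩
  ∑ (level r) (λ y → 1 + 2 ^ ℓ * at χ y)
    ≡⟨ trans (∑-+ (level r) _ _) (cong₂ _+_ (∑-const (level r) 1) (∑-*ˡ (level r) (2 ^ ℓ) _)) ⟩
  length (level r) * 1 + 2 ^ ℓ * ∑ (level r) (at χ)
    ≡⟨ cong₂ (λ a b → a + 2 ^ ℓ * b) (trans (*-identityʳ _) (length-applyUpTo (2 ^ r +_) (2 ^ r)))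
                                     (∑-applyUpTo (2 ^ r +_) (2 ^ r) (at χ)) ⟩
  2 ^ r + 2 ^ ℓ * sum (applyUpTo (λ i → at χ (2 ^ r + i)) (2 ^ r))
    ≤⟨ +-monoʳ-≤ (2 ^ r) (*-monoʳ-≤ (2 ^ ℓ) (≤-trans (sum-at≤∣∣ χ (2 ^ r) (2 ^ r)) ∣χ∣≤2^κ)) ⟩
  2 ^ r + 2 ^ ℓ * 2 ^ κ
    ≡⟨ cong (2 ^ r +_) (trans (*-comm (2 ^ ℓ) _) (sym (^-distribˡ-+-* 2 κ ℓ))) ⟩
  2 ^ r + 2 ^ (κ + ℓ)
    ≤⟨ +-monoʳ-≤ (2 ^ r) (^-monoʳ-≤ 2 κ+ℓ≤r) ⟩
  2 ^ r + 2 ^ r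
    ≡⟨ trans (cong (2 ^ r +_) (sym (+-identityʳ _))) (*-comm 2 (2 ^ r)) ⟩
  2 ^ r * 2 ∎
  where open ≤-Reasoning

-- The levels are independent, so the factor 2 of `∑-level` is paid once for each of the first `j`
-- levels.
∑-choices : (χ : Subset n) → ∀ κ ℓ → ∣ χ ∣ ≤ 2 ^ κ →
            ∀ j rs → All (κ + ℓ ≤_) (take j rs) →
            ∑ (choices rs) (λ x → 2 ^ (ℓ * deg χ j x)) ≤ length (choices rs) * 2 ^ j
∑-choices χ κ ℓ ∣χ∣≤ zero rs _ = begin
  ∑ (choices rs) (λ x → 2 ^ (ℓ * 0)) ≡⟨ ∑-const (choices rs) _ ⟩
  length (choices rs) * 2 ^ (ℓ * 0)  ≡⟨ cong (λ e → length (choices rs) * 2 ^ e) (*-zeroʳ ℓ) ⟩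
  length (choices rs) * 1            ∎
  where open ≤-Reasoning
∑-choices χ κ ℓ ∣χ∣≤ (suc j) [] _ rewrite *-zeroʳ ℓ | +-identityʳ (2 ^ suc j) = m^n>0 2 (suc j)
∑-choices χ κ ℓ ∣χ∣≤ (suc j) (r ∷ rs) (κ+ℓ≤r ∷ κ+ℓ≤rs) = begin
  ∑ (choices (r ∷ rs)) (λ x → 2 ^ (ℓ * deg χ (suc j) x))
    ≡⟨ ∑-cartesianProductWith _∷_ (level r) (choices rs) _ ⟩
  ∑ (level r) (λ y → ∑ (choices rs) (λ x → 2 ^ (ℓ * (at χ y + deg χ j x))))
    ≡⟨ ∑-cong (level r) (λ y → trans (∑-cong (choices rs) (λ x → split (at χ y) (deg χ j x)))
                                     (∑-*ˡ (choices rs) (2 ^ (ℓ * at χ y)) _)) ⟩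
  ∑ (level r) (λ y → 2 ^ (ℓ * at χ y) * ∑ (choices rs) (λ x → 2 ^ (ℓ * deg χ j x)))
    ≡⟨ ∑-*ʳ (level r) _ _ ⟩
  ∑ (level r) (λ y → 2 ^ (ℓ * at χ y)) * ∑ (choices rs) (λ x → 2 ^ (ℓ * deg χ j x))
    ≤⟨ *-mono-≤ (∑-level χ κ ℓ r ∣χ∣≤ κ+ℓ≤r) (∑-choices χ κ ℓ ∣χ∣≤ j rs κ+ℓ≤rs) ⟩
  2 ^ r * 2 * (length (choices rs) * 2 ^ j)
    ≡⟨ rearrange (2 ^ r) (length (choices rs)) (2 ^ j) ⟩
  2 ^ r * length (choices rs) * (2 * 2 ^ j)
    ≡⟨ cong (_* (2 * 2 ^ j)) (length-choices-∷ r rs) ⟨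
  length (choices (r ∷ rs)) * 2 ^ suc j ∎
  where
  open ≤-Reasoning
  split : ∀ a b → 2 ^ (ℓ * (a + b)) ≡ 2 ^ (ℓ * a) * 2 ^ (ℓ * b)
  split a b = trans (cong (2 ^_) (*-distribˡ-+ ℓ a b)) (^-distribˡ-+-* 2 (ℓ * a) (ℓ * b))
  rearrange : ∀ a b c → a * 2 * (b * c) ≡ a * b * (2 * c)
  rearrange = solve-∀

∑ˢ : (X → ℕ) → Subset n → Vec X n → ℕ
∑ˢ d []      []      = 0
∑ˢ d (b ∷ S) (x ∷ v) = 𝟙 b * d x + ∑ˢ d S v

-- Keep the second summand of the factors in S and the first one elsewhere.
∏-lowerBound : ∀ z u ℓ (d : X → ℕ) (S : Subset n) (v : Vec X n) →
  2 ^ (z * n + u * ∣ S ∣ + ℓ * ∑ˢ d S v) ≤ 2 ^ (z * ∣ S ∣) * ∏ (λ x → 2 ^ z + 2 ^ (u + ℓ * d x)) v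
∏-lowerBound z u ℓ d [] [] rewrite *-zeroʳ z | *-zeroʳ u | *-zeroʳ ℓ = ≤-refl
∏-lowerBound {n = suc n} z u ℓ d (true ∷ S) (x ∷ v) = begin
  2 ^ (z * suc n + u * suc ∣ S ∣ + ℓ * (d x + 0 + ∑ˢ d S v))
    ≡⟨ cong (2 ^_) (exponent z u ℓ n ∣ S ∣ (d x) (∑ˢ d S v)) ⟩
  2 ^ (z + (u + ℓ * d x) + (z * n + u * ∣ S ∣ + ℓ * ∑ˢ d S v))
    ≡⟨ trans (^-distribˡ-+-* 2 (z + (u + ℓ * d x)) _) (cong (_* _) (^-distribˡ-+-* 2 z (u + ℓ * d x))) ⟩
  2 ^ z * 2 ^ (u + ℓ * d x) * 2 ^ (z * n + u * ∣ S ∣ + ℓ * ∑ˢ d S v)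
    ≤⟨ *-mono-≤ (*-monoʳ-≤ (2 ^ z) (m≤n+m (2 ^ (u + ℓ * d x)) (2 ^ z))) (∏-lowerBound z u ℓ d S v) ⟩
  2 ^ z * (2 ^ z + 2 ^ (u + ℓ * d x)) * (2 ^ (z * ∣ S ∣) * ∏ _ v)
    ≡⟨ rearrange (2 ^ z) (2 ^ z + 2 ^ (u + ℓ * d x)) (2 ^ (z * ∣ S ∣)) _ ⟩
  2 ^ z * 2 ^ (z * ∣ S ∣) * ((2 ^ z + 2 ^ (u + ℓ * d x)) * ∏ _ v)
    ≡⟨ cong (_* _) (trans (sym (^-distribˡ-+-* 2 z (z * ∣ S ∣))) (cong (2 ^_) (sym (*-suc z ∣ S ∣)))) ⟩
  2 ^ (z * suc ∣ S ∣) * ((2 ^ z + 2 ^ (u + ℓ * d x)) * ∏ _ v) ∎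
  where
  open ≤-Reasoning
  exponent : ∀ z u ℓ n m d D → z * suc n + u * suc m + ℓ * (d + 0 + D) ≡ z + (u + ℓ * d) + (z * n + u * m + ℓ * D)
  exponent = solve-∀
  rearrange : ∀ a b c d → a * b * (c * d) ≡ a * c * (b * d)
  rearrange = solve-∀
∏-lowerBound {n = suc n} z u ℓ d (false ∷ S) (x ∷ v) = begin
  2 ^ (z * suc n + u * ∣ S ∣ + ℓ * ∑ˢ d S v)
    ≡⟨ cong (2 ^_) (exponent z n (u * ∣ S ∣) (ℓ * ∑ˢ d S v)) ⟩
  2 ^ (z + (z * n + u * ∣ S ∣ + ℓ * ∑ˢ d S v))
    ≡⟨ ^-distribˡ-+-* 2 z _ ⟩
  2 ^ z * 2 ^ (z * n + u * ∣ S ∣ + ℓ * ∑ˢ d S v)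
    ≤⟨ *-mono-≤ (m≤m+n (2 ^ z) (2 ^ (u + ℓ * d x))) (∏-lowerBound z u ℓ d S v) ⟩
  (2 ^ z + 2 ^ (u + ℓ * d x)) * (2 ^ (z * ∣ S ∣) * ∏ _ v)
    ≡⟨ rearrange (2 ^ z + 2 ^ (u + ℓ * d x)) (2 ^ (z * ∣ S ∣)) _ ⟩
  2 ^ (z * ∣ S ∣) * ((2 ^ z + 2 ^ (u + ℓ * d x)) * ∏ _ v) ∎
  where
  open ≤-Reasoning
  exponent : ∀ z n a b → z * suc n + a + b ≡ z + (z * n + a + b)
  exponent = solve-∀
  rearrange : ∀ a b c → a * (b * c) ≡ b * (a * c)
  rearrange = solve-∀

-- The union bound

^-distribʳ-* : ∀ n a b → (a * b) ^ n ≡ a ^ n * b ^ n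
^-distribʳ-* zero    a b = refl
^-distribʳ-* (suc n) a b = trans (cong (a * b *_) (^-distribʳ-* n a b)) (rearrange a b (a ^ n) (b ^ n))
  where
  rearrange : ∀ a b c d → a * b * (c * d) ≡ a * c * (b * d)
  rearrange = solve-∀

-- With `d` standing for `L ∸ m`, this is `(1 + 1/L) ^ m ≤ 1 / (1 - m/L)`. The induction rests on
-- `suc L * d ≤ L * suc d`, that is, `d ≤ L`.
bernoulli : ∀ {L} m d → m + d ≡ L → suc L ^ m * d ≤ L ^ m * L
bernoulli {L} zero    d refl = ≤-refl
bernoulli {L} (suc m) d eq   = begin
  suc L * suc L ^ m * d   ≡⟨ rearrange (suc L) (suc L ^ m) d ⟩
  suc L ^ m * (d + L * d) ≤⟨ *-monoʳ-≤ (suc L ^ m) (+-monoˡ-≤ (L * d) (subst (d ≤_) eq (m≤n+m d (suc m)))) ⟩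
  suc L ^ m * (L + L * d) ≡⟨ rearrange′ (suc L ^ m) L d ⟩
  L * (suc L ^ m * suc d) ≤⟨ *-monoʳ-≤ L (bernoulli m (suc d) (trans (+-suc m d) eq)) ⟩
  L * (L ^ m * L)         ≡⟨ *-assoc L (L ^ m) L ⟨
  L * L ^ m * L           ∎
  where
  open ≤-Reasoning
  rearrange : ∀ a b c → a * b * c ≡ b * (a * c)
  rearrange = solve-∀
  rearrange′ : ∀ a b c → a * (b + b * c) ≡ b * (a * suc c)
  rearrange′ = solve-∀

-- For `L = 2 ^ q` with `q` positive, `bernoulli` at `L / 2` gives `(1 + 1/L) ^ (L / 2) ≤ 2`;
-- squaring gives 4.
[1+2^q]^2^q≤4* : ∀ q → suc (2 ^ q) ^ 2 ^ q ≤ 4 * (2 ^ q) ^ 2 ^ q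
[1+2^q]^2^q≤4* zero    = s≤s (s≤s z≤n)
[1+2^q]^2^q≤4* (suc q) = begin
  suc L ^ (h + (h + 0))             ≡⟨ square (suc L) ⟩
  suc L ^ h * suc L ^ h             ≤⟨ *-mono-≤ half half ⟩
  L ^ h * 2 * (L ^ h * 2)           ≡⟨ rearrange (L ^ h) ⟩
  4 * (L ^ h * L ^ h)               ≡⟨ cong (4 *_) (square L) ⟨
  4 * L ^ (h + (h + 0))             ∎
  where
  open ≤-Reasoning
  h L : ℕ
  h = 2 ^ q
  L = 2 ^ suc q
  square : ∀ a → a ^ (h + (h + 0)) ≡ a ^ h * a ^ h
  square a = trans (cong (λ k → a ^ (h + k)) (+-identityʳ h)) (^-distribˡ-+-* a h h)
  rearrange : ∀ a → a * 2 * (a * 2) ≡ 4 * (a * a)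
  rearrange = solve-∀
  half : suc L ^ h ≤ L ^ h * 2
  half = *-cancelʳ-≤ _ _ h {{m^n≢0 2 q}} (≤-trans (bernoulli {L} h h (cong (h +_) (sym (+-identityʳ h))))
    (≤-reflexive (sym (*-assoc (L ^ h) 2 h))))

-- Pad `n` by `d` to the multiple `2 ^ q * K` and raise the previous bound to the power `K`; the
-- padding is cancelled as a factor `L ^ d`.
[1+2^q]^n≤4^K* : ∀ q {n K} → n ≤ 2 ^ q * K → suc (2 ^ q) ^ n ≤ 4 ^ K * (2 ^ q) ^ n
[1+2^q]^n≤4^K* q {n} {K} n≤LK with d , n+d≡LK ← m≤n⇒∃[o]m+o≡n n≤LK =
  *-cancelʳ-≤ _ _ (L ^ d) {{m^n≢0 L d {{m^n≢0 2 q}}}} (begin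
    suc L ^ n * L ^ d     ≤⟨ *-monoʳ-≤ (suc L ^ n) (^-monoˡ-≤ d (n≤1+n L)) ⟩
    suc L ^ n * suc L ^ d ≡⟨ ^-distribˡ-+-* (suc L) n d ⟨
    suc L ^ (n + d)       ≡⟨ cong (suc L ^_) n+d≡LK ⟩
    suc L ^ (L * K)       ≡⟨ ^-*-assoc (suc L) L K ⟨
    (suc L ^ L) ^ K       ≤⟨ ^-monoˡ-≤ K ([1+2^q]^2^q≤4* q) ⟩
    (4 * L ^ L) ^ K       ≡⟨ ^-distribʳ-* K 4 (L ^ L) ⟩
    4 ^ K * (L ^ L) ^ K   ≡⟨ cong (4 ^ K *_) (^-*-assoc L L K) ⟩
    4 ^ K * L ^ (L * K)   ≡⟨ cong (λ e → 4 ^ K * L ^ e) n+d≡LK ⟨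
    4 ^ K * L ^ (n + d)   ≡⟨ cong (4 ^ K *_) (^-distribˡ-+-* L n d) ⟩
    4 ^ K * (L ^ n * L ^ d) ≡⟨ *-assoc (4 ^ K) (L ^ n) (L ^ d) ⟨
    4 ^ K * L ^ n * L ^ d ∎)
  where
  open ≤-Reasoning
  L : ℕ
  L = 2 ^ q

-- Divided by `2 ^ (p * n)`: the total relative weight `(1 + 2 ^ κ / 2 ^ p) ^ n` of all subsets is
-- at most `4 ^ 2 ^ κ`. This takes the place of an estimate of binomial coefficients.
[2^κ+2^p]^n≤ : ∀ {κ p n} → κ ≤ p → n ≤ 2 ^ p → (2 ^ κ + 2 ^ p) ^ n ≤ 2 ^ (2 * 2 ^ κ + p * n)
[2^κ+2^p]^n≤ {κ} {p} {n} κ≤p n≤2^p with q , refl ← m≤n⇒∃[o]m+o≡n κ≤p = begin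
  (2 ^ κ + 2 ^ (κ + q)) ^ n
    ≡⟨ cong (_^ n) (trans (cong (2 ^ κ +_) (^-distribˡ-+-* 2 κ q)) (sym (*-suc (2 ^ κ) (2 ^ q)))) ⟩
  (2 ^ κ * suc (2 ^ q)) ^ n
    ≡⟨ ^-distribʳ-* n (2 ^ κ) (suc (2 ^ q)) ⟩
  (2 ^ κ) ^ n * suc (2 ^ q) ^ n
    ≤⟨ *-monoʳ-≤ ((2 ^ κ) ^ n) ([1+2^q]^n≤4^K* q (≤-trans n≤2^p (≤-reflexive
         (trans (^-distribˡ-+-* 2 κ q) (*-comm (2 ^ κ) (2 ^ q)))))) ⟩
  (2 ^ κ) ^ n * (4 ^ 2 ^ κ * (2 ^ q) ^ n)
    ≡⟨ cong₂ _*_ (^-*-assoc 2 κ n) (cong₂ _*_ (^-*-assoc 2 2 (2 ^ κ)) (^-*-assoc 2 q n)) ⟩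
  2 ^ (κ * n) * (2 ^ (2 * 2 ^ κ) * 2 ^ (q * n))
    ≡⟨ cong (2 ^ (κ * n) *_) (^-distribˡ-+-* 2 (2 * 2 ^ κ) (q * n)) ⟨
  2 ^ (κ * n) * 2 ^ (2 * 2 ^ κ + q * n)
    ≡⟨ ^-distribˡ-+-* 2 (κ * n) _ ⟨
  2 ^ (κ * n + (2 * 2 ^ κ + q * n))
    ≡⟨ cong (2 ^_) (exponent κ q n (2 ^ κ)) ⟩
  2 ^ (2 * 2 ^ κ + (κ + q) * n) ∎
  where
  open ≤-Reasoning
  exponent : ∀ κ q n K → κ * n + (2 * K + q * n) ≡ 2 * K + (κ + q) * n
  exponent = solve-∀

∑2^<2^ : ∀ p → ∑ (downFrom p) (2 ^_) < 2 ^ p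
∑2^<2^ zero    = z<s
∑2^<2^ (suc p) = begin-strict
  2 ^ p + ∑ (downFrom p) (2 ^_) <⟨ +-monoʳ-< (2 ^ p) (∑2^<2^ p) ⟩
  2 ^ p + 2 ^ p                 ≡⟨ cong (2 ^ p +_) (+-identityʳ (2 ^ p)) ⟨
  2 ^ suc p                     ∎
  where open ≤-Reasoning

2^-cancel-< : ∀ {a b} → 2 ^ a < 2 ^ b → a < b
2^-cancel-< {a} {b} lt with a <? b
... | yes a<b = a<b
... | no  a≮b = contradiction (^-monoʳ-≤ 2 (≮⇒≥ a≮b)) (<⇒≱ lt)

∑ˢ-zero : (S : Subset n) (v : Vec X n) → ∑ˢ (λ _ → 0) S v ≡ 0
∑ˢ-zero []      []      = refl
∑ˢ-zero (b ∷ S) (x ∷ v) = cong₂ _+_ (*-zeroʳ (𝟙 b)) (∑ˢ-zero S v)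

-- For sets of size about `2 ^ κ`, `j κ` counts the levels treated and `ℓ κ` is the number of bits
-- that an incidence is worth. `κ+ℓ≤r` keeps the exponential moments bounded; `ℓ-large` says that 7
-- incidences per vertex outweigh the cost of the union bound.
module UnionBound
  {n p t : ℕ} (rs : List ℕ) (j ℓ : ℕ → ℕ)
  (n≤2^p : n ≤ 2 ^ p)
  (j≤t : ∀ κ → κ ≤ p → j κ ≤ t)
  (κ+ℓ≤r : ∀ κ → κ ≤ p → All (κ + ℓ κ ≤_) (take (j κ) rs))
  (ℓ-large : ∀ κ → κ ≤ p → j κ ≡ 0 ⊎ 3 * (p ∸ κ) + j κ + 9 ≤ 7 * ℓ κ)
  where

  -- The left set `S` is absent: expanding the product of the factors `g` over the left vertices
  -- already sums over all `S`.
  Config : Set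
  Config = ℕ × Subset n

  small : ℕ → List (Subset n)
  small κ = filter (λ χ → ∣ χ ∣ ≤? 2 ^ κ) (subsets n)

  configs : List Config
  configs = concatMap (λ κ → map (κ ,_) (small κ)) (downFrom (suc p))

  ∈-configs⁺ : ∀ {κ χ} → κ ≤ p → ∣ χ ∣ ≤ 2 ^ κ → (κ , χ) ∈ configs
  ∈-configs⁺ {κ} {χ} κ≤p ∣χ∣≤ = ∈-concatMap⁺ _ (lose (∈-downFrom⁺ (s≤s κ≤p))
    (∈-map⁺ (κ ,_) (∈-filter⁺ (λ χ → ∣ χ ∣ ≤? 2 ^ κ) (∈-subsets χ) ∣χ∣≤)))

  ∈-configs⁻ : ∀ {c} → c ∈ configs → proj₁ c ≤ p × ∣ proj₂ c ∣ ≤ 2 ^ proj₁ c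
  ∈-configs⁻ c∈
    with κ , κ∈ , c∈κ ← find (∈-concatMap⁻ (λ κ → map (κ ,_) (small κ)) {downFrom (suc p)} c∈)
    with χ , χ∈ , refl ← ∈-map⁻ (κ ,_) c∈κ
    = s≤s⁻¹ (∈-downFrom⁻ κ∈)
    , proj₂ (∈-filter⁻ (λ χ → ∣ χ ∣ ≤? 2 ^ κ) {xs = subsets n} χ∈)

  -- Probabilities scaled to integers.  Relative to the leading terms 2 ^ p and
  -- 2 ^ (p + t), an element of χ has weight 1 / 2 ^ (p ∸ κ), an element of S has
  -- weight 1 / 2 ^ (p ∸ κ + j κ), and every incidence between them gains 2 ^ ℓ κ.
  w : Config → ℕ
  w (κ , χ) = 2 ^ (4 * (2 ^ p ∸ 2 ^ κ) + κ) * weight (2 ^ κ) (2 ^ p) χ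

  g : Config → List ℕ → ℕ
  g (κ , χ) x = 2 ^ (p + t) + 2 ^ (κ + (t ∸ j κ) + ℓ κ * deg χ (j κ) x)

  G : Config → ℕ
  G (κ , χ) = 2 ^ (p + t) + 2 ^ (κ + t)

  -- The moment bound costs a factor `2 ^ j κ`, for which the exponent `t ∸ j κ` in `g` makes room.
  -- Hence the bound `G c` involves neither `χ` nor `j κ`.
  ∑g≤ : ∀ {c} → c ∈ configs → ∑ (choices rs) (g c) ≤ length (choices rs) * G c
  ∑g≤ {c@(κ , χ)} c∈ with κ≤p , ∣χ∣≤ ← ∈-configs⁻ c∈ = begin
    ∑ (choices rs) (g c)
      ≡⟨ ∑-+ (choices rs) _ _ ⟩
    ∑ (choices rs) (λ _ → 2 ^ (p + t)) + ∑ (choices rs) (λ x → 2 ^ (u + ℓ κ * deg χ (j κ) x))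
      ≡⟨ cong₂ _+_ (∑-const (choices rs) (2 ^ (p + t)))
           (trans (∑-cong (choices rs) (λ x → ^-distribˡ-+-* 2 u (ℓ κ * deg χ (j κ) x)))
                  (∑-*ˡ (choices rs) (2 ^ u) _)) ⟩
    N * 2 ^ (p + t) + 2 ^ u * ∑ (choices rs) (λ x → 2 ^ (ℓ κ * deg χ (j κ) x))
      ≤⟨ +-monoʳ-≤ (N * 2 ^ (p + t)) (*-monoʳ-≤ (2 ^ u)
           (∑-choices χ κ (ℓ κ) ∣χ∣≤ (j κ) rs (κ+ℓ≤r κ κ≤p))) ⟩
    N * 2 ^ (p + t) + 2 ^ u * (N * 2 ^ j κ)
      ≡⟨ cong (N * 2 ^ (p + t) +_) (rearrange (2 ^ u) N (2 ^ j κ)) ⟩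
    N * 2 ^ (p + t) + N * (2 ^ u * 2 ^ j κ)
      ≡⟨ *-distribˡ-+ N (2 ^ (p + t)) (2 ^ u * 2 ^ j κ) ⟨
    N * (2 ^ (p + t) + 2 ^ u * 2 ^ j κ)
      ≡⟨ cong (λ a → N * (2 ^ (p + t) + a)) (sym (^-distribˡ-+-* 2 u (j κ))) ⟩
    N * (2 ^ (p + t) + 2 ^ (u + j κ))
      ≡⟨ cong (λ e → N * (2 ^ (p + t) + 2 ^ e))
           (trans (+-assoc κ (t ∸ j κ) (j κ)) (cong (κ +_) (m∸n+n≡m (j≤t κ κ≤p)))) ⟩
    N * G c ∎
    where
    open ≤-Reasoning
    N u : ℕ
    N = length (choices rs)
    u = κ + (t ∸ j κ)
    rearrange : ∀ a b c → a * (b * c) ≡ b * (a * c)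
    rearrange = solve-∀

  -- A common exponent for all `κ`: the sums over `χ` and over `S` contribute `2 * 2 ^ κ` each,
  -- which the term `4 * (2 ^ p ∸ 2 ^ κ)` in `w` complements to `4 * 2 ^ p`. The further `κ` in `w`
  -- makes the sum over all sizes geometric.
  Y : ℕ
  Y = 4 * 2 ^ p + (2 * p + t) * n

  ∑-κ≤ : ∀ {κ} → κ ≤ p → ∑ (map (κ ,_) (small κ)) (λ c → w c * G c ^ n) ≤ 2 ^ Y * 2 ^ κ
  ∑-κ≤ {κ} κ≤p = begin
    ∑ (map (κ ,_) (small κ)) (λ c → w c * G c ^ n)
      ≡⟨ ∑-map (κ ,_) (small κ) _ ⟩
    ∑ (small κ) (λ χ → 2 ^ y * weight (2 ^ κ) (2 ^ p) χ * Gκ ^ n)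
      -- Admitting subsets of every size makes the binomial theorem applicable.
      ≤⟨ ∑-filter (λ χ → ∣ χ ∣ ≤? 2 ^ κ) (subsets n) _ ⟩
    ∑ (subsets n) (λ χ → 2 ^ y * weight (2 ^ κ) (2 ^ p) χ * Gκ ^ n)
      ≡⟨ trans (∑-*ʳ (subsets n) (Gκ ^ n) _) (cong (_* Gκ ^ n)
           (trans (∑-*ˡ (subsets n) (2 ^ y) _) (cong (2 ^ y *_) (∑-weight n (2 ^ κ) (2 ^ p))))) ⟩
    2 ^ y * (2 ^ κ + 2 ^ p) ^ n * Gκ ^ n
      ≡⟨ cong (λ a → 2 ^ y * (2 ^ κ + 2 ^ p) ^ n * a) Gκ^n≡ ⟩
    2 ^ y * (2 ^ κ + 2 ^ p) ^ n * ((2 ^ κ + 2 ^ p) ^ n * 2 ^ (t * n))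
      ≤⟨ *-mono-≤ (*-monoʳ-≤ (2 ^ y) le) (*-monoˡ-≤ (2 ^ (t * n)) le) ⟩
    2 ^ y * 2 ^ E * (2 ^ E * 2 ^ (t * n))
      ≡⟨ cong₂ _*_ (^-distribˡ-+-* 2 y E) (^-distribˡ-+-* 2 E (t * n)) ⟨
    2 ^ (y + E) * 2 ^ (E + t * n)
      ≡⟨ ^-distribˡ-+-* 2 (y + E) _ ⟨
    2 ^ (y + E + (E + t * n))
      ≡⟨ cong (2 ^_) (trans (exponent (2 ^ κ) (2 ^ p ∸ 2 ^ κ) κ p t n)
           (cong (λ a → 4 * a + (2 * p + t) * n + κ) (m+[n∸m]≡n (^-monoʳ-≤ 2 κ≤p)))) ⟩
    2 ^ (Y + κ)
      ≡⟨ ^-distribˡ-+-* 2 Y κ ⟩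
    2 ^ Y * 2 ^ κ ∎
    where
    open ≤-Reasoning
    y E Gκ : ℕ
    y  = 4 * (2 ^ p ∸ 2 ^ κ) + κ
    E  = 2 * 2 ^ κ + p * n
    Gκ = 2 ^ (p + t) + 2 ^ (κ + t)
    le : (2 ^ κ + 2 ^ p) ^ n ≤ 2 ^ E
    le = [2^κ+2^p]^n≤ κ≤p n≤2^p
    exponent : ∀ K c κ p t n → 4 * c + κ + (2 * K + p * n) + (2 * K + p * n + t * n) ≡ 4 * (K + c) + (2 * p + t) * n + κ
    exponent = solve-∀
    factor : ∀ a b c → a * c + b * c ≡ (b + a) * c
    factor = solve-∀
    Gκ^n≡ : Gκ ^ n ≡ (2 ^ κ + 2 ^ p) ^ n * 2 ^ (t * n)
    Gκ^n≡ = begin-equality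
      Gκ ^ n
        ≡⟨ cong (_^ n) (trans (cong₂ _+_ (^-distribˡ-+-* 2 p t) (^-distribˡ-+-* 2 κ t))
                              (factor (2 ^ p) (2 ^ κ) (2 ^ t))) ⟩
      ((2 ^ κ + 2 ^ p) * 2 ^ t) ^ n
        ≡⟨ ^-distribʳ-* n (2 ^ κ + 2 ^ p) (2 ^ t) ⟩
      (2 ^ κ + 2 ^ p) ^ n * (2 ^ t) ^ n
        ≡⟨ cong ((2 ^ κ + 2 ^ p) ^ n *_) (^-*-assoc 2 t n) ⟩
      (2 ^ κ + 2 ^ p) ^ n * 2 ^ (t * n) ∎

  ∑-configs< : ∑ configs (λ c → w c * G c ^ n) < 2 ^ (Y + suc p)
  ∑-configs< = begin-strict
    ∑ configs (λ c → w c * G c ^ n)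
      ≡⟨ ∑-concatMap (λ κ → map (κ ,_) (small κ)) (downFrom (suc p)) _ ⟩
    ∑ (downFrom (suc p)) (λ κ → ∑ (map (κ ,_) (small κ)) (λ c → w c * G c ^ n))
      ≤⟨ ∑-mono-∈ (downFrom (suc p)) (λ κ∈ → ∑-κ≤ (s≤s⁻¹ (∈-downFrom⁻ κ∈))) ⟩
    ∑ (downFrom (suc p)) (λ κ → 2 ^ Y * 2 ^ κ)
      ≡⟨ ∑-*ˡ (downFrom (suc p)) (2 ^ Y) _ ⟩
    2 ^ Y * ∑ (downFrom (suc p)) (2 ^_)
      <⟨ *-monoʳ-< (2 ^ Y) {{m^n≢0 2 Y}} (∑2^<2^ (suc p)) ⟩
    2 ^ Y * 2 ^ suc p
      ≡⟨ ^-distribˡ-+-* 2 Y (suc p) ⟨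
    2 ^ (Y + suc p) ∎
    where open ≤-Reasoning

  -- A single configuration, with a single `S` from the expanded product, weighs no more than the
  -- whole potential. The first two summands on the right clear the denominators in `weight-2^` and
  -- `∏-lowerBound`.
  exponent< : (v : Vec (List ℕ) n) → ∑ configs (λ c → w c * ∏ (g c) v) < 2 ^ (Y + suc p) →
    ∀ κ → κ ≤ p → (S χ : Subset n) → ∣ S ∣ ≡ ∣ χ ∣ → ∣ χ ∣ ≤ 2 ^ κ →
    4 * (2 ^ p ∸ 2 ^ κ) + κ + (p * n + κ * ∣ χ ∣)
      + ((p + t) * n + (κ + (t ∸ j κ)) * ∣ S ∣ + ℓ κ * ∑ˢ (deg χ (j κ)) S v)
    < p * ∣ χ ∣ + (p + t) * ∣ S ∣ + (Y + suc p)
  exponent< v lt κ κ≤p S χ ∣S∣≡∣χ∣ ∣χ∣≤ = 2^-cancel-< (begin-strict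
    2 ^ (y + e₁ + e₂)
      ≡⟨ trans (^-distribˡ-+-* 2 (y + e₁) e₂) (cong (_* 2 ^ e₂) (^-distribˡ-+-* 2 y e₁)) ⟩
    2 ^ y * 2 ^ e₁ * 2 ^ e₂
      ≤⟨ *-mono-≤ (≤-reflexive (cong (2 ^ y *_) (sym (weight-2^ κ p χ))))
                  (∏-lowerBound (p + t) (κ + (t ∸ j κ)) (ℓ κ) (deg χ (j κ)) S v) ⟩
    2 ^ y * (2 ^ f₁ * weight (2 ^ κ) (2 ^ p) χ) * (2 ^ f₂ * ∏ (g c) v)
      ≡⟨ rearrange (2 ^ y) (2 ^ f₁) (weight (2 ^ κ) (2 ^ p) χ) (2 ^ f₂) (∏ (g c) v) ⟩
    2 ^ f₁ * 2 ^ f₂ * (w c * ∏ (g c) v)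
      ≤⟨ *-monoʳ-≤ (2 ^ f₁ * 2 ^ f₂) (∈⇒≤∑ (λ c → w c * ∏ (g c) v) (∈-configs⁺ {κ} {χ} κ≤p ∣χ∣≤)) ⟩
    2 ^ f₁ * 2 ^ f₂ * ∑ configs (λ c → w c * ∏ (g c) v)
      ≡⟨ cong (_* ∑ configs (λ c → w c * ∏ (g c) v)) (^-distribˡ-+-* 2 f₁ f₂) ⟨
    2 ^ (f₁ + f₂) * ∑ configs (λ c → w c * ∏ (g c) v)
      <⟨ *-monoʳ-< (2 ^ (f₁ + f₂)) {{m^n≢0 2 (f₁ + f₂)}} lt ⟩
    2 ^ (f₁ + f₂) * 2 ^ (Y + suc p)
      ≡⟨ ^-distribˡ-+-* 2 (f₁ + f₂) _ ⟨
    2 ^ (f₁ + f₂ + (Y + suc p)) ∎)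
    where
    open ≤-Reasoning
    c : Config
    c = κ , χ
    y e₁ e₂ f₁ f₂ : ℕ
    y  = 4 * (2 ^ p ∸ 2 ^ κ) + κ
    e₁ = p * n + κ * ∣ χ ∣
    e₂ = (p + t) * n + (κ + (t ∸ j κ)) * ∣ S ∣ + ℓ κ * ∑ˢ (deg χ (j κ)) S v
    f₁ = p * ∣ χ ∣
    f₂ = (p + t) * ∣ S ∣
    rearrange : ∀ a b c d e → a * (b * c) * (d * e) ≡ b * d * (a * c * e)
    rearrange = solve-∀

  -- With `m = ∣ S ∣` and `q = p ∸ κ`, more than `7 * m` incidences worth `ℓ κ` each would exceed
  -- the cost: `2 * q + j κ` per vertex for the relative weights, `4 * 2 ^ κ` for the number of
  -- sets, and `suc q` for the sum over `κ`. As `2 ^ κ < 2 * m`, the cost is at most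
  -- `(3 * q + j κ + 9) * m`.
  ∑ˢ-deg≤ : (v : Vec (List ℕ) n) → ∑ configs (λ c → w c * ∏ (g c) v) < 2 ^ (Y + suc p) →
    ∀ κ → κ ≤ p → (S χ : Subset n) → ∣ S ∣ ≡ ∣ χ ∣ → ∣ S ∣ ≤ 2 ^ κ → 2 ^ κ < 2 * ∣ S ∣ →
    ∑ˢ (deg χ (j κ)) S v ≤ 7 * ∣ S ∣
  ∑ˢ-deg≤ v lt κ κ≤p S χ ∣S∣≡∣χ∣ ∣S∣≤2^κ 2^κ<2∣S∣ with ℓ-large κ κ≤p
  ... | inj₁ j≡0 rewrite j≡0 | ∑ˢ-zero S v = z≤n
  ... | inj₂ large with ∑ˢ (deg χ (j κ)) S v ≤? 7 * ∣ S ∣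
  ...   | yes D≤ = D≤
  ...   | no  D≰ = contradiction ℓD< (≤⇒≯ ≤ℓD)
    where
    open ≤-Reasoning
    m D q s c : ℕ
    m = ∣ S ∣
    D = ∑ˢ (deg χ (j κ)) S v
    q = p ∸ κ
    s = t ∸ j κ
    c = 2 ^ p ∸ 2 ^ κ
    -- What both exponents share once `p`, `t` and `2 ^ p` are split as `κ + q`, `j κ + s` and
    -- `2 ^ κ + c`.
    Common : ℕ
    Common = 4 * c + κ + ((κ + q) * n + κ * m) + ((κ + q + (j κ + s)) * n + (κ + s) * m)
    lhs : ∀ c κ q n m j s D → 4 * c + κ + ((κ + q) * n + κ * m) + ((κ + q + (j + s)) * n + (κ + s) * m + D)
          ≡ 4 * c + κ + ((κ + q) * n + κ * m) + ((κ + q + (j + s)) * n + (κ + s) * m) + D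
    lhs = solve-∀
    rhs : ∀ c κ q n m j s K → (κ + q) * m + (κ + q + (j + s)) * m + (4 * (K + c) + (2 * (κ + q) + (j + s)) * n + suc (κ + q))
          ≡ 4 * c + κ + ((κ + q) * n + κ * m) + ((κ + q + (j + s)) * n + (κ + s) * m) + (2 * q * m + j * m + 4 * K + suc q)
    rhs = solve-∀
    ℓD< : ℓ κ * D < 2 * q * m + j κ * m + 4 * 2 ^ κ + suc q
    ℓD< = +-cancelˡ-< Common _ _ (subst₂ _<_ (lhs c κ q n m (j κ) s (ℓ κ * D)) (rhs c κ q n m (j κ) s (2 ^ κ)) (lemma
      (m+[n∸m]≡n κ≤p) (m+[n∸m]≡n (j≤t κ κ≤p)) (m+[n∸m]≡n (^-monoʳ-≤ 2 κ≤p))))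
      where
      lemma : ∀ {p′ t′ P′} → p′ ≡ p → t′ ≡ t → P′ ≡ 2 ^ p →
        4 * c + κ + (p′ * n + κ * m) + ((p′ + t′) * n + (κ + s) * m + ℓ κ * D)
        < p′ * m + (p′ + t′) * m + (4 * P′ + (2 * p′ + t′) * n + suc p′)
      lemma refl refl refl = subst (λ m′ → 4 * c + κ + (p * n + κ * m′) + ((p + t) * n + (κ + s) * m + ℓ κ * D)
        < p * m′ + (p + t) * m + (Y + suc p)) (sym ∣S∣≡∣χ∣)
        (exponent< v lt κ κ≤p S χ ∣S∣≡∣χ∣ (subst (_≤ 2 ^ κ) ∣S∣≡∣χ∣ ∣S∣≤2^κ))
    1≤m : 1 ≤ m
    1≤m = *-cancelˡ-< 2 0 m (≤-<-trans z≤n 2^κ<2∣S∣)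
    regroup : ∀ q j m → 2 * q * m + j * m + 4 * (2 * m) + suc q * m ≡ (3 * q + j + 9) * m
    regroup = solve-∀
    assoc : ∀ ℓ m → 7 * ℓ * m ≡ ℓ * (7 * m)
    assoc = solve-∀
    ≤ℓD : 2 * q * m + j κ * m + 4 * 2 ^ κ + suc q ≤ ℓ κ * D
    ≤ℓD = begin
      2 * q * m + j κ * m + 4 * 2 ^ κ + suc q
        ≤⟨ +-mono-≤ (+-monoʳ-≤ (2 * q * m + j κ * m) (*-monoʳ-≤ 4 (<⇒≤ 2^κ<2∣S∣)))
                    (m≤m*n (suc q) m {{>-nonZero 1≤m}}) ⟩
      2 * q * m + j κ * m + 4 * (2 * m) + suc q * m
        ≡⟨ regroup q (j κ) m ⟩
      (3 * q + j κ + 9) * m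
        ≤⟨ *-monoˡ-≤ m large ⟩
      7 * ℓ κ * m
        ≡⟨ assoc (ℓ κ) m ⟩
      ℓ κ * (7 * m)
        ≤⟨ *-monoʳ-≤ (ℓ κ) (≰⇒≥ D≰) ⟩
      ℓ κ * D ∎

  sparseChoices :
    ∃[ v ] VecAll.All (_∈ choices rs) {n} v ×
      (∀ κ → κ ≤ p → (S χ : Subset n) → ∣ S ∣ ≡ ∣ χ ∣ → ∣ S ∣ ≤ 2 ^ κ → 2 ^ κ < 2 * ∣ S ∣ →
       ∑ˢ (deg χ (j κ)) S v ≤ 7 * ∣ S ∣)
  sparseChoices
    with v , v∈ , le ← conditionalExpectations configs (choices rs) (0<length-choices rs) g G ∑g≤ n w
    = v , v∈ , ∑ˢ-deg≤ v (≤-<-trans le ∑-configs<)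

-- Greedy independent sets

∑-tabulate : (h : Fin n → A) (f : A → ℕ) → ∑ (List.tabulate h) f ≡ sumᶠ (f ∘ h)
∑-tabulate {n = zero}  h f = refl
∑-tabulate {n = suc n} h f = cong (f (h zero) +_) (∑-tabulate (h ∘ suc) f)

∑ᶠ : (Fin n → ℕ) → ℕ
∑ᶠ = ∑ (allFin _)

∑ᶠ≡sum : (f : Fin n → ℕ) → ∑ᶠ f ≡ sumᶠ f
∑ᶠ≡sum = ∑-tabulate (λ a → a)

∑ᶠ-suc : (f : Fin (suc n) → ℕ) → ∑ᶠ f ≡ f zero + ∑ᶠ (f ∘ suc)
∑ᶠ-suc f = trans (∑ᶠ≡sum f) (cong (f zero +_) (sym (∑ᶠ≡sum (f ∘ suc))))

≤∑ᶠ : (f : Fin n → ℕ) → ∀ a → f a ≤ ∑ᶠ f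
≤∑ᶠ f a = ∈⇒≤∑ f (∈-allFin a)

∑ᶠ-const : ∀ n c → ∑ᶠ {n} (λ _ → c) ≡ n * c
∑ᶠ-const n c = trans (∑-const (allFin n) c) (cong (_* c) (length-tabulate {n = n} _))

∣∣≡∑ᶠ : (S : Subset n) → ∣ S ∣ ≡ ∑ᶠ (𝟙 ∘ lookup S)
∣∣≡∑ᶠ []      = refl
∣∣≡∑ᶠ (b ∷ S) = trans (∣∷∣ b S) (trans (cong (𝟙 b +_) (∣∣≡∑ᶠ S)) (sym (∑ᶠ-suc (𝟙 ∘ lookup (b ∷ S)))))

∑ˢ≡∑ᶠ : (d : X → ℕ) (S : Subset n) (v : Vec X n) →
        ∑ˢ d S v ≡ ∑ᶠ (λ a → 𝟙 (lookup S a) * d (lookup v a))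
∑ˢ≡∑ᶠ d []      []      = refl
∑ˢ≡∑ᶠ d (b ∷ S) (x ∷ v) = trans (cong (𝟙 b * d x +_) (∑ˢ≡∑ᶠ d S v))
  (sym (∑ᶠ-suc (λ a → 𝟙 (lookup (b ∷ S) a) * d (lookup (x ∷ v) a))))

δ : Fin n → Fin n → ℕ
δ a b = 𝟙 (does (a ≟ b))

∑ᶠ-δ : (a : Fin n) (f : Fin n → ℕ) → ∑ᶠ (λ b → δ a b * f b) ≡ f a
∑ᶠ-δ {suc n} zero    f = trans (∑ᶠ-suc (λ b → δ zero b * f b))
  (trans (cong (f zero + 0 +_) (∑-zero (allFin n))) (trans (+-identityʳ _) (+-identityʳ _)))
∑ᶠ-δ {suc n} (suc a) f = trans (∑ᶠ-suc (λ b → δ (suc a) b * f b)) (∑ᶠ-δ a (f ∘ suc))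

∑ᶠ-δ₁ : (a : Fin n) → ∑ᶠ (δ a) ≡ 1
∑ᶠ-δ₁ a = trans (∑-cong (allFin _) (λ b → sym (*-identityʳ (δ a b)))) (∑ᶠ-δ a (λ _ → 1))

∑ᶠ≤1 : (f : Fin n → ℕ) → (∀ a → f a ≤ 1) → (∀ a b → 1 ≤ f a → 1 ≤ f b → a ≡ b) → ∑ᶠ f ≤ 1
∑ᶠ≤1 {n} f f≤1 unique with any? (λ a → 1 ≤? f a)
... | no  none = ≤-trans (∑-mono (allFin n) (λ a → ≮⇒≥ (λ 1≤fa → none (a , 1≤fa))))
                         (≤-trans (≤-reflexive (∑-zero (allFin n))) z≤n)
... | yes (a , 1≤fa) = ≤-trans (∑-mono (allFin n) f≤δ) (≤-reflexive (∑ᶠ-δ₁ a))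
  where
  f≤δ : ∀ b → f b ≤ δ a b
  f≤δ b with a ≟ b
  ... | yes _  = f≤1 b
  ... | no a≢b = ≮⇒≥ (λ 1≤fb → a≢b (unique a b 1≤fa 1≤fb))

infix 4 _⊆ᵇ_
_⊆ᵇ_ : (S T : Fin n → Bool) → Set
S ⊆ᵇ T = ∀ a → S a ≡ true → T a ≡ true

card : (Fin n → Bool) → ℕ
card S = ∑ᶠ (𝟙 ∘ S)

card≤ : (S : Fin n → Bool) → card S ≤ n
card≤ {n} S = ≤-trans (∑-mono (allFin n) (𝟙≤1 ∘ S)) (≤-reflexive (trans (∑ᶠ-const n 1) (*-identityʳ n)))

card-mono : {S T : Fin n → Bool} → S ⊆ᵇ T → card S ≤ card T
card-mono {n} {S} {T} S⊆T = ∑-mono (allFin n) le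
  where
  le : ∀ a → 𝟙 (S a) ≤ 𝟙 (T a)
  le a with S a in eq
  ... | false = z≤n
  ... | true  = ≤-reflexive (sym (cong 𝟙 (S⊆T a eq)))

InjectiveOn : (Fin n → Bool) → (Fin n → A) → Set
InjectiveOn S π = ∀ a b → S a ≡ true → S b ≡ true → π a ≡ π b → a ≡ b

-- `E` is any test that at most one point passes, so that equality in `Fin n` and equality of `toℕ`
-- values are both covered.
preimages≤1 : (S : Fin n → Bool) (π : Fin n → A) (E : A → Bool) → InjectiveOn S π →
              (∀ x y → E x ≡ true → E y ≡ true → x ≡ y) → ∑ᶠ (λ a → 𝟙 (S a) * 𝟙 (E (π a))) ≤ 1
preimages≤1 S π E inj E-unique = ∑ᶠ≤1 _ (λ a → *-mono-≤ (𝟙≤1 (S a)) (𝟙≤1 (E (π a)))) unique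
  where
  split : ∀ b c → 1 ≤ 𝟙 b * 𝟙 c → b ≡ true × c ≡ true
  split true true _ = refl , refl
  unique : ∀ a b → 1 ≤ 𝟙 (S a) * 𝟙 (E (π a)) → 1 ≤ 𝟙 (S b) * 𝟙 (E (π b)) → a ≡ b
  unique a b pa pb with Sa , Ea ← split _ _ pa | Sb , Eb ← split _ _ pb = inj a b Sa Sb (E-unique _ _ Ea Eb)

does-≟-sound : (c a b : Fin n) → does (a ≟ c) ≡ true → does (b ≟ c) ≡ true → a ≡ b
does-≟-sound c a b pa pb with yes refl ← a ≟ c | yes refl ← b ≟ c = refl

-- Write `f (π a)` as a sum over the possible values of `π a` and exchange the sums; each value is
-- taken at most once on `S`.
∑ᶠ-injective : (S : Fin n → Bool) (π : Fin n → Fin n) → InjectiveOn S π →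
               (f : Fin n → ℕ) → ∑ᶠ (λ a → 𝟙 (S a) * f (π a)) ≤ ∑ᶠ f
∑ᶠ-injective {n} S π inj f = begin
  ∑ᶠ (λ a → 𝟙 (S a) * f (π a))
    ≡⟨ ∑-cong (allFin n) (λ a → trans (cong (𝟙 (S a) *_) (sym (∑ᶠ-δ (π a) f))) (sym (∑-*ˡ (allFin n) (𝟙 (S a)) _))) ⟩
  ∑ᶠ (λ a → ∑ᶠ (λ b → 𝟙 (S a) * (δ (π a) b * f b)))
    ≡⟨ ∑-swap (allFin n) (allFin n) _ ⟩
  ∑ᶠ (λ b → ∑ᶠ (λ a → 𝟙 (S a) * (δ (π a) b * f b)))
    ≡⟨ ∑-cong (allFin n) (λ b → trans (∑-cong (allFin n) (λ a → sym (*-assoc (𝟙 (S a)) (δ (π a) b) (f b))))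
                                      (∑-*ʳ (allFin n) (f b) _)) ⟩
  ∑ᶠ (λ b → ∑ᶠ (λ a → 𝟙 (S a) * δ (π a) b) * f b)
    ≤⟨ ∑-mono (allFin n) (λ b → *-monoˡ-≤ (f b) (preimages≤1 S π (λ c → does (c ≟ b)) inj (does-≟-sound b))) ⟩
  ∑ᶠ (λ b → 1 * f b)
    ≡⟨ ∑-cong (allFin n) (λ b → *-identityˡ (f b)) ⟩
  ∑ᶠ f ∎
  where open ≤-Reasoning

-- Dropping a member of `S` with value above `c` makes the inequality strict for the rest, which
-- also shows that the rest still meets `S`.
∑≤⇒∃≤-on : (xs : List A) (S : A → Bool) (f : A → ℕ) (c : ℕ) → 0 < ∑ xs (𝟙 ∘ S) →
           ∑ xs (λ x → 𝟙 (S x) * f x) ≤ c * ∑ xs (𝟙 ∘ S) → ∃[ x ] S x ≡ true × f x ≤ c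
∑≤⇒∃≤-on (x ∷ xs) S f c pos le with S x in Sx
... | false = ∑≤⇒∃≤-on xs S f c pos le
... | true with f x ≤? c
...   | yes fx≤c = x , Sx , fx≤c
...   | no  fx≰c = ∑≤⇒∃≤-on xs S f c
          (*-cancelˡ-< c 0 _ (≤-<-trans (≤-reflexive (*-zeroʳ c)) (≤-<-trans z≤n rest<)))
          (<⇒≤ rest<)
  where
  open ≤-Reasoning
  rest< : ∑ xs (λ x → 𝟙 (S x) * f x) < c * ∑ xs (𝟙 ∘ S)
  rest< = +-cancelˡ-< c _ _ (begin-strict
    c + ∑ xs (λ x → 𝟙 (S x) * f x)       <⟨ +-monoˡ-< _ (≰⇒> fx≰c) ⟩
    f x + ∑ xs (λ x → 𝟙 (S x) * f x)     ≡⟨ cong (_+ ∑ xs (λ x → 𝟙 (S x) * f x)) (+-identityʳ (f x)) ⟨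
    f x + 0 + ∑ xs (λ x → 𝟙 (S x) * f x) ≤⟨ le ⟩
    c * suc (∑ xs (𝟙 ∘ S))               ≡⟨ *-suc c _ ⟩
    c + c * ∑ xs (𝟙 ∘ S)                 ∎)

-- Ordered pairs, diagonal included: `adj` need not be symmetric, because it will record whether `a`
-- is joined to the partner of `b`.
edges : (Fin n → Fin n → ℕ) → (Fin n → Bool) → ℕ
edges adj S = ∑ᶠ (λ a → 𝟙 (S a) * ∑ᶠ (λ b → 𝟙 (S b) * adj a b))

Independent : (Fin n → Fin n → ℕ) → (Fin n → Bool) → Set
Independent adj I = ∀ a b → I a ≡ true → I b ≡ true → a ≢ b → adj a b ≡ 0

-- Greedy: averaging gives a vertex of total degree at most 2 c; pick it, discard its neighbours, repeat.
independentSet : (adj : Fin n → Fin n → ℕ) (c : ℕ) (N : ℕ) (S : Fin n → Bool) → card S ≤ N →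
  (∀ a → S a ≡ true → 1 ≤ adj a a) →
  (∀ T → T ⊆ᵇ S → edges adj T ≤ c * card T) →
  ∃[ I ] I ⊆ᵇ S × Independent adj I × card S ≤ 2 * c * card I
independentSet {n} adj c N S card≤N loops sparse with 0 <? card S
... | no card≮0 = (λ _ → false) , (λ a ()) , (λ a b ()) , ≤-trans (≮⇒≥ card≮0) z≤n
independentSet {n} adj c zero S card≤N loops sparse | yes 0<card = contradiction card≤N (<⇒≱ 0<card)
independentSet {n} adj c (suc N) S card≤N loops sparse | yes 0<card =
  pick (∑≤⇒∃≤-on (allFin n) S degree (2 * c) 0<card ∑degree≤)
  where
  open ≤-Reasoning
  -- Both directions are counted, whence the 2 in `2 * c`.
  degree : Fin n → ℕ
  degree a = ∑ᶠ (λ b → 𝟙 (S b) * (adj a b + adj b a))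

  double : ∀ a → a + a ≡ 2 * a
  double = solve-∀

  swap : ∀ a b c → a * (b * c) ≡ b * (a * c)
  swap = solve-∀

  ∑degree≤ : ∑ᶠ (λ a → 𝟙 (S a) * degree a) ≤ 2 * c * card S
  ∑degree≤ = begin
    ∑ᶠ (λ a → 𝟙 (S a) * degree a)
      ≡⟨ ∑-cong (allFin n) (λ a → trans
           (cong (𝟙 (S a) *_) (trans (∑-cong (allFin n) (λ b → *-distribˡ-+ (𝟙 (S b)) (adj a b) (adj b a)))
                                     (∑-+ (allFin n) _ _)))
           (*-distribˡ-+ (𝟙 (S a)) _ _)) ⟩
    ∑ᶠ (λ a → 𝟙 (S a) * ∑ᶠ (λ b → 𝟙 (S b) * adj a b) + 𝟙 (S a) * ∑ᶠ (λ b → 𝟙 (S b) * adj b a))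
      ≡⟨ ∑-+ (allFin n) _ _ ⟩
    edges adj S + ∑ᶠ (λ a → 𝟙 (S a) * ∑ᶠ (λ b → 𝟙 (S b) * adj b a))
      ≡⟨ cong (edges adj S +_) transposed ⟩
    edges adj S + edges adj S
      ≡⟨ double (edges adj S) ⟩
    2 * edges adj S
      ≤⟨ *-monoʳ-≤ 2 (sparse S (λ _ Sa → Sa)) ⟩
    2 * (c * card S)
      ≡⟨ *-assoc 2 c (card S) ⟨
    2 * c * card S ∎
    where
    transposed : ∑ᶠ (λ a → 𝟙 (S a) * ∑ᶠ (λ b → 𝟙 (S b) * adj b a)) ≡ edges adj S
    transposed = begin-equality
      ∑ᶠ (λ a → 𝟙 (S a) * ∑ᶠ (λ b → 𝟙 (S b) * adj b a))
        ≡⟨ ∑-cong (allFin n) (λ a → sym (∑-*ˡ (allFin n) (𝟙 (S a)) _)) ⟩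
      ∑ᶠ (λ a → ∑ᶠ (λ b → 𝟙 (S a) * (𝟙 (S b) * adj b a)))
        ≡⟨ ∑-swap (allFin n) (allFin n) _ ⟩
      ∑ᶠ (λ b → ∑ᶠ (λ a → 𝟙 (S a) * (𝟙 (S b) * adj b a)))
        ≡⟨ ∑-cong (allFin n) (λ b → trans (∑-cong (allFin n) (λ a → swap (𝟙 (S a)) (𝟙 (S b)) (adj b a)))
                                          (∑-*ˡ (allFin n) (𝟙 (S b)) _)) ⟩
      edges adj S ∎

  pick : ∃[ v ] S v ≡ true × degree v ≤ 2 * c →
    ∃[ I ] I ⊆ᵇ S × Independent adj I × card S ≤ 2 * c * card I
  pick (v , Sv , deg-v) = extend
      (independentSet adj c N S′ (s≤s⁻¹ (≤-trans card-S′< card≤N))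
        (λ a → loops a ∘ S′⊆S a) (λ T T⊆S′ → sparse T (λ a → S′⊆S a ∘ T⊆S′ a)))
    where
    -- The loop at `v` makes `v` its own neighbour: it leaves the set, and `degree v` already
    -- accounts for it.
    S′ : Fin n → Bool
    S′ w = S w ∧ (adj v w + adj w v ≡ᵇ 0)

    nonNeighbour : ∀ w → S′ w ≡ true → S w ≡ true × adj v w ≡ 0 × adj w v ≡ 0
    nonNeighbour w with S w | adj v w | adj w v
    ... | true | zero | zero = λ _ → refl , refl , refl

    S′⊆S : S′ ⊆ᵇ S
    S′⊆S w = proj₁ ∘ nonNeighbour w

    v∉S′ : S′ v ≢ true
    v∉S′ S′v with _ , eq , _ ← nonNeighbour v S′v = contradiction eq (>⇒≢ (loops v Sv))

    card-S′< : suc (card S′) ≤ card S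
    card-S′< = begin
      suc (card S′)                 ≡⟨ cong (_+ card S′) (∑ᶠ-δ₁ v) ⟨
      ∑ᶠ (δ v) + card S′            ≡⟨ ∑-+ (allFin n) _ _ ⟨
      ∑ᶠ (λ w → δ v w + 𝟙 (S′ w))   ≤⟨ ∑-mono (allFin n) le ⟩
      card S                        ∎
      where
      le : ∀ w → δ v w + 𝟙 (S′ w) ≤ 𝟙 (S w)
      le w with v ≟ w | S′ w in S′w
      ... | yes refl | true  = contradiction S′w v∉S′
      ... | yes refl | false = ≤-reflexive (sym (cong 𝟙 Sv))
      ... | no _     | true  = ≤-reflexive (sym (cong 𝟙 (S′⊆S w S′w)))
      ... | no _     | false = z≤n

    card-S≤ : card S ≤ card S′ + 2 * c
    card-S≤ = begin
      card S               ≤⟨ ∑-mono (allFin n) (λ w → le (S w) (adj v w + adj w v)) ⟩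
      ∑ᶠ (λ w → 𝟙 (S′ w) + 𝟙 (S w) * (adj v w + adj w v)) ≡⟨ ∑-+ (allFin n) _ _ ⟩
      card S′ + degree v   ≤⟨ +-monoʳ-≤ (card S′) deg-v ⟩
      card S′ + 2 * c      ∎
      where
      le : ∀ s m → 𝟙 s ≤ 𝟙 (s ∧ (m ≡ᵇ 0)) + 𝟙 s * m
      le false m       = z≤n
      le true  zero    = s≤s z≤n
      le true  (suc m) = s≤s z≤n

    extend : ∃[ I ] I ⊆ᵇ S′ × Independent adj I × card S′ ≤ 2 * c * card I →
      ∃[ I ] I ⊆ᵇ S × Independent adj I × card S ≤ 2 * c * card I
    extend (I′ , I′⊆S′ , indep′ , card-S′≤) = I , I⊆S , indep , card-S≤′
      where
      I : Fin n → Bool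
      I w = does (v ≟ w) ∨ I′ w

      cases : ∀ w → I w ≡ true → v ≡ w ⊎ I′ w ≡ true
      cases w Iw with v ≟ w
      ... | yes v≡w = inj₁ v≡w
      ... | no  _   = inj₂ Iw

      I⊆S : I ⊆ᵇ S
      I⊆S w Iw with cases w Iw
      ... | inj₁ refl = Sv
      ... | inj₂ I′w  = S′⊆S w (I′⊆S′ w I′w)

      indep : ∀ a b → I a ≡ true → I b ≡ true → a ≢ b → adj a b ≡ 0
      indep a b Ia Ib a≢b with cases a Ia | cases b Ib
      ... | inj₁ refl | inj₁ refl = contradiction refl a≢b
      ... | inj₁ refl | inj₂ I′b  = proj₁ (proj₂ (nonNeighbour b (I′⊆S′ b I′b)))
      ... | inj₂ I′a  | inj₁ refl = proj₂ (proj₂ (nonNeighbour a (I′⊆S′ a I′a)))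
      ... | inj₂ I′a  | inj₂ I′b  = indep′ a b I′a I′b a≢b

      card-I : card I ≡ suc (card I′)
      card-I = trans (∑-cong (allFin n) eq) (trans (∑-+ (allFin n) _ _) (cong (_+ card I′) (∑ᶠ-δ₁ v)))
        where
        eq : ∀ w → 𝟙 (I w) ≡ δ v w + 𝟙 (I′ w)
        eq w with v ≟ w | I′ w in I′w
        ... | yes refl | true  = contradiction (I′⊆S′ w I′w) v∉S′
        ... | yes refl | false = refl
        ... | no _     | _     = refl

      card-S≤′ : card S ≤ 2 * c * card I
      card-S≤′ = begin
        card S                    ≤⟨ card-S≤ ⟩
        card S′ + 2 * c           ≤⟨ +-monoˡ-≤ (2 * c) card-S′≤ ⟩
        2 * c * card I′ + 2 * c   ≡⟨ trans (+-comm _ (2 * c)) (sym (*-suc (2 * c) (card I′))) ⟩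
        2 * c * suc (card I′)     ≡⟨ cong (2 * c *_) card-I ⟨
        2 * c * card I            ∎

-- Matchings in sparse graphs

-- Descend from an exponent `P` that suffices until the next smaller one fails; the last component
-- records minimality.
log-⌈⌉ : ∀ b m P → 1 ≤ m → m ≤ b ^ P → ∃[ p ] m ≤ b ^ p × (p ≡ 0 ⊎ ∃[ p′ ] p ≡ suc p′ × b ^ p′ < m)
log-⌈⌉ b m zero    1≤m m≤1 = 0 , m≤1 , inj₁ refl
log-⌈⌉ b m (suc P) 1≤m m≤b^P with m ≤? b ^ P
... | yes m≤ = log-⌈⌉ b m P 1≤m m≤
... | no  m≰ = suc P , m≤b^P , inj₂ (P , refl , ≰⇒> m≰)

n<2^n : ∀ n → n < 2 ^ n
n<2^n zero    = z<s
n<2^n (suc n) = ≤-trans (+-mono-≤ (m^n>0 2 n) (n<2^n n)) (≤-reflexive (cong (2 ^ n +_) (sym (+-identityʳ _))))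

log₂-⌈⌉ : ∀ m → 1 ≤ m → ∃[ p ] m ≤ 2 ^ p × 2 ^ p < 2 * m
log₂-⌈⌉ m 1≤m with log-⌈⌉ 2 m m 1≤m (<⇒≤ (n<2^n m))
... | p , m≤2^p , inj₁ refl              = 0 , m≤2^p , *-monoʳ-≤ 2 1≤m
... | p , m≤2^p , inj₂ (p′ , refl , lt) = p , m≤2^p , *-monoʳ-< 2 lt

2^p<2m⇒p≤ : ∀ {p q m} → 2 ^ p < 2 * m → m ≤ 2 ^ q → p ≤ q
2^p<2m⇒p≤ 2^p<2m m≤2^q = s≤s⁻¹ (2^-cancel-< (<-≤-trans 2^p<2m (*-monoʳ-≤ 2 m≤2^q)))

at-tabulate : (F : ℕ → Bool) → (∀ y → n ≤ y → F y ≡ false) → ∀ y → at (tabulate {n = n} (F ∘ toℕ)) y ≡ 𝟙 (F y)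
at-tabulate {zero}  F F≥n y       = sym (cong 𝟙 (F≥n y z≤n))
at-tabulate {suc n} F F≥n zero    = refl
at-tabulate {suc n} F F≥n (suc y) = at-tabulate (F ∘ suc) (λ y → F≥n (suc y) ∘ s≤s) y

∣tabulate∣ : (F : Fin n → Bool) → ∣ tabulate F ∣ ≡ card F
∣tabulate∣ F = trans (∣∣≡∑ᶠ (tabulate F)) (∑-cong (allFin _) (λ a → cong 𝟙 (lookup∘tabulate F a)))

≡ᵇ-sound : ∀ m n → (m ≡ᵇ n) ≡ true → m ≡ n
≡ᵇ-sound m n eq = ≡ᵇ⇒≡ m n (subst T (sym eq) _)

≡ᵇ-refl : ∀ m → (m ≡ᵇ m) ≡ true
≡ᵇ-refl zero    = refl
≡ᵇ-refl (suc m) = ≡ᵇ-refl m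

≢⇒≡ᵇ : ∀ {m n} → m ≢ n → (m ≡ᵇ n) ≡ false
≢⇒≡ᵇ {m} {n} m≢n with m ≡ᵇ n in eq
... | true  = contradiction (≡ᵇ-sound m n eq) m≢n
... | false = refl

δ≡≡ᵇ : (a b : Fin n) → δ a b ≡ 𝟙 (toℕ a ≡ᵇ toℕ b)
δ≡≡ᵇ zero    zero    = refl
δ≡≡ᵇ zero    (suc b) = refl
δ≡≡ᵇ (suc a) zero    = refl
δ≡≡ᵇ (suc a) (suc b) = δ≡≡ᵇ a b

∑ᶠ-<ᵇ : ∀ n θ → ∑ᶠ {n} (λ b → 𝟙 (toℕ b <ᵇ θ)) ≤ θ
∑ᶠ-<ᵇ zero    θ       = z≤n
∑ᶠ-<ᵇ (suc n) zero    = ≤-reflexive (∑-zero (allFin (suc n)))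
∑ᶠ-<ᵇ (suc n) (suc θ) = ≤-trans (≤-reflexive (∑ᶠ-suc {n} (λ b → 𝟙 (toℕ b <ᵇ suc θ)))) (s≤s (∑ᶠ-<ᵇ n θ))

any≤∑ : (f : A → Bool) (xs : List A) → 𝟙 (any f xs) ≤ ∑ xs (𝟙 ∘ f)
any≤∑ f []       = z≤n
any≤∑ f (x ∷ xs) with f x
... | true  = s≤s z≤n
... | false = any≤∑ f xs

𝟙-1≤ᵇ : ∀ {m} → m ≤ 1 → 𝟙 (1 ≤ᵇ m) ≡ m
𝟙-1≤ᵇ z≤n       = refl
𝟙-1≤ᵇ (s≤s z≤n) = refl

-- Used for the level at index `j`, just after those of the union bound: it holds one neighbour, and
-- the later ones vanish by hypothesis.
∑-drop≤1 : (f : A → ℕ) → (∀ y → f y ≤ 1) → ∀ j xs → All (λ y → f y ≡ 0) (drop (suc j) xs) → ∑ (drop j xs) f ≤ 1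
∑-drop≤1 f f≤1 zero    []       _  = z≤n
∑-drop≤1 f f≤1 zero    (x ∷ xs) f≡0 = ≤-trans (+-mono-≤ (f≤1 x) (≤-reflexive (vanish xs f≡0))) (≤-reflexive (+-identityʳ 1))
  where
  vanish : ∀ xs → All (λ y → f y ≡ 0) xs → ∑ xs f ≡ 0
  vanish []       []         = refl
  vanish (x ∷ xs) (eq ∷ eqs) = cong₂ _+_ eq (vanish xs eqs)
∑-drop≤1 f f≤1 (suc j) []       _  = z≤n
∑-drop≤1 f f≤1 (suc j) (x ∷ xs) f≡0 = ∑-drop≤1 f f≤1 j xs f≡0

-- The partners of `S` form the set `χ` for the union bound. Injectivity makes `hits` their
-- indicator and gives the image the size of `S`.
module Image (S : Fin n → Bool) (π : Fin n → Fin n) (inj : InjectiveOn S π) where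

  hits : ℕ → ℕ
  hits y = ∑ᶠ (λ a → 𝟙 (S a) * 𝟙 (toℕ (π a) ≡ᵇ y))

  hits≤1 : ∀ y → hits y ≤ 1
  hits≤1 y = preimages≤1 S π (λ b → toℕ b ≡ᵇ y) inj
    (λ b c pb pc → toℕ-injective (trans (≡ᵇ-sound _ y pb) (sym (≡ᵇ-sound _ y pc))))

  hits≡0 : ∀ y → (∀ a → S a ≡ true → toℕ (π a) ≢ y) → hits y ≡ 0
  hits≡0 y miss = trans (∑-cong (allFin n) zero-term) (∑-zero (allFin n))
    where
    zero-term : ∀ a → 𝟙 (S a) * 𝟙 (toℕ (π a) ≡ᵇ y) ≡ 0
    zero-term a with S a in Sa
    ... | false = refl
    ... | true rewrite ≢⇒≡ᵇ (miss a Sa) = refl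

  image : Subset n
  image = tabulate (λ b → 1 ≤ᵇ hits (toℕ b))

  at-image : ∀ y → at image y ≡ hits y
  at-image y = trans
    (at-tabulate (λ y → 1 ≤ᵇ hits y)
      (λ y n≤y → cong (1 ≤ᵇ_) (hits≡0 y (λ a _ eq → <⇒≱ (toℕ<n (π a)) (subst (n ≤_) (sym eq) n≤y)))) y)
    (𝟙-1≤ᵇ (hits≤1 y))

  ∣image∣ : ∣ image ∣ ≡ card S
  ∣image∣ = begin
    ∣ image ∣
      ≡⟨ ∣tabulate∣ {n} (λ b → 1 ≤ᵇ hits (toℕ b)) ⟩
    ∑ᶠ {n} (λ b → 𝟙 (1 ≤ᵇ hits (toℕ b)))
      ≡⟨ ∑-cong (allFin n) (λ b → 𝟙-1≤ᵇ (hits≤1 (toℕ b))) ⟩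
    ∑ᶠ {n} (λ b → ∑ᶠ {n} (λ a → 𝟙 (S a) * 𝟙 (toℕ (π a) ≡ᵇ toℕ b)))
      ≡⟨ ∑-swap (allFin n) (allFin n) (λ b a → 𝟙 (S a) * 𝟙 (toℕ (π a) ≡ᵇ toℕ b)) ⟩
    ∑ᶠ {n} (λ a → ∑ᶠ {n} (λ b → 𝟙 (S a) * 𝟙 (toℕ (π a) ≡ᵇ toℕ b)))
      ≡⟨ ∑-cong (allFin n) (λ a → trans (∑-*ˡ (allFin n) (𝟙 (S a)) (λ b → 𝟙 (toℕ (π a) ≡ᵇ toℕ b)))
           (trans (cong (𝟙 (S a) *_) (trans (∑-cong (allFin n) (λ b → sym (δ≡≡ᵇ (π a) b))) (∑ᶠ-δ₁ (π a))))
                  (*-identityʳ _))) ⟩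
    card S ∎
    where open ≡-Reasoning

-- Since `θ` is at most an eighth of `s`, the first hypothesis gives `7 * s ≤ 128 * i`, and 128 is
-- rounded up to 140, which is `7 * 20`.
s≤20i : ∀ {s i θ} → s ≤ 2 * 8 * i + θ → 8 * θ ≤ s → s ≤ 20 * i
s≤20i {s} {i} {θ} s≤ 8θ≤s = *-cancelˡ-≤ 7 (+-cancelˡ-≤ s _ _ (begin
  8 * s                       ≤⟨ *-monoʳ-≤ 8 s≤ ⟩
  8 * (16 * i + θ)            ≡⟨ *-distribˡ-+ 8 (16 * i) θ ⟩
  8 * (16 * i) + 8 * θ        ≤⟨ +-mono-≤ (≤-trans (≤-reflexive (sym (*-assoc 8 16 i))) (*-monoˡ-≤ i (m≤m+n 128 12))) 8θ≤s ⟩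
  140 * i + s                 ≡⟨ cong (_+ s) (*-assoc 7 20 i) ⟩
  7 * (20 * i) + s            ≡⟨ +-comm (7 * (20 * i)) s ⟩
  s + 7 * (20 * i)            ∎))
  where open ≤-Reasoning

8θ≤s : ∀ {s θ κ} → θ * 16 ≤ 2 ^ κ → 2 ^ κ < 2 * s → 8 * θ ≤ s
8θ≤s {s} {θ} {κ} 16θ≤ 2^κ< = *-cancelˡ-≤ 2 (begin
  2 * (8 * θ)  ≡⟨ *-assoc 2 8 θ ⟨
  16 * θ       ≡⟨ *-comm 16 θ ⟩
  θ * 16       ≤⟨ 16θ≤ ⟩
  2 ^ κ        ≤⟨ <⇒≤ 2^κ< ⟩
  2 * s        ∎)
  where open ≤-Reasoning

-- Induced matchings in graphs of sparse choices

graph : (Fin n → List ℕ) → BipartiteGraph n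
graph x a = tabulate (λ b → any (toℕ b ≡ᵇ_) (x a))

-- `sparse` covers the first `j κ` levels and `tail` those from index `suc (j κ)` on; the one level
-- between them costs at most one edge per left vertex.
module Multitasking
  {n p : ℕ} (x : Fin n → List ℕ) (j : ℕ → ℕ) (n≤2^p : n ≤ 2 ^ p)
  (sparse : ∀ κ → κ ≤ p → (S χ : Subset n) → ∣ S ∣ ≡ ∣ χ ∣ → ∣ S ∣ ≤ 2 ^ κ → 2 ^ κ < 2 * ∣ S ∣ →
            ∑ᶠ (λ a → 𝟙 (lookup S a) * deg χ (j κ) (x a)) ≤ 7 * ∣ S ∣)
  (tail : ∀ κ → κ ≤ p → ∀ a → All (λ y → y < 2 ^ κ ℕ./ 16) (drop (suc (j κ)) (x a)))
  where

  G : BipartiteGraph n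
  G = graph x

  adj : Fin n → Fin n → ℕ
  adj a b = 𝟙 (any (toℕ b ≡ᵇ_) (x a))

  ∈G⇒adj : ∀ {a b} → b Subset.∈ G a → adj a b ≡ 1
  ∈G⇒adj {a} {b} b∈ = cong 𝟙 (trans (sym (lookup∘tabulate _ b)) ([]=⇒lookup b∈))

  -- After contraction of each `a` with `π a`, the first levels give at most `7 * card S` edges and
  -- the next one at most `card S`; all later neighbours are smaller than every partner. `κ` may
  -- exceed the logarithm of `card S`, so that one threshold serves all subsets of a matching.
  edges≤ : ∀ κ → (S : Fin n → Bool) (π : Fin n → Fin n) → InjectiveOn S π →
           (∀ a → S a ≡ true → 2 ^ κ ℕ./ 16 ≤ toℕ (π a)) → card S ≤ 2 ^ κ →
           edges (λ a b → adj a (π b)) S ≤ 8 * card S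
  edges≤ κ S π inj large card≤2^κ with 0 <? card S
  ... | no card≮0 = ≤-trans (≤-reflexive (trans (∑-cong (allFin n) vanish) (∑-zero (allFin n)))) z≤n
    where
    vanish : ∀ a → 𝟙 (S a) * ∑ᶠ (λ b → 𝟙 (S b) * adj a (π b)) ≡ 0
    vanish a rewrite n≤0⇒n≡0 (≤-trans (≤∑ᶠ (𝟙 ∘ S) a) (≮⇒≥ card≮0)) = refl
  ... | yes 0<card = begin
    ∑ᶠ (λ a → 𝟙 (S a) * ∑ᶠ (λ b → 𝟙 (S b) * adj a (π b)))
      ≤⟨ ∑-mono (allFin n) (λ a → *-monoʳ-≤ (𝟙 (S a)) (row a)) ⟩
    ∑ᶠ (λ a → 𝟙 (S a) * (deg image (j κ′) (x a) + 1))
      ≡⟨ trans (∑-cong (allFin n) (λ a → *-distribˡ-+ (𝟙 (S a)) (deg image (j κ′) (x a)) 1)) (∑-+ (allFin n) _ _) ⟩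
    ∑ᶠ (λ a → 𝟙 (S a) * deg image (j κ′) (x a)) + ∑ᶠ (λ a → 𝟙 (S a) * 1)
      ≡⟨ cong₂ _+_ (∑-cong (allFin n) (λ a → cong (λ b → 𝟙 b * deg image (j κ′) (x a)) (sym (lookup∘tabulate S a))))
                   (∑-cong (allFin n) (λ a → *-identityʳ (𝟙 (S a)))) ⟩
    ∑ᶠ (λ a → 𝟙 (lookup (tabulate S) a) * deg image (j κ′) (x a)) + card S
      ≤⟨ +-monoˡ-≤ (card S) (sparse κ′ κ′≤p (tabulate S) image
           (trans (∣tabulate∣ S) (sym ∣image∣))
           (subst (_≤ 2 ^ κ′) (sym (∣tabulate∣ S)) card≤2^κ′)
           (subst (λ m → 2 ^ κ′ < 2 * m) (sym (∣tabulate∣ S)) 2^κ′<)) ⟩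
    7 * ∣ tabulate S ∣ + card S
      ≡⟨ cong (λ m → 7 * m + card S) (∣tabulate∣ S) ⟩
    7 * card S + card S
      ≡⟨ +-comm (7 * card S) (card S) ⟩
    8 * card S ∎
    where
    open ≤-Reasoning
    open Image S π inj
    ceil : ∃[ κ′ ] card S ≤ 2 ^ κ′ × 2 ^ κ′ < 2 * card S
    ceil = log₂-⌈⌉ (card S) 0<card
    κ′ : ℕ
    κ′ = proj₁ ceil
    card≤2^κ′ : card S ≤ 2 ^ κ′
    card≤2^κ′ = proj₁ (proj₂ ceil)
    2^κ′< : 2 ^ κ′ < 2 * card S
    2^κ′< = proj₂ (proj₂ ceil)
    κ′≤p : κ′ ≤ p
    κ′≤p = 2^p<2m⇒p≤ 2^κ′< (≤-trans (card≤ S) n≤2^p)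
    κ′≤κ : κ′ ≤ κ
    κ′≤κ = 2^p<2m⇒p≤ 2^κ′< card≤2^κ
    -- As `κ′ ≤ κ`, the threshold for the actual size of `S` is no higher than the one that `large`
    -- guarantees.
    missed : ∀ {y} → y < 2 ^ κ′ ℕ./ 16 → hits y ≡ 0
    missed {y} y< = hits≡0 y (λ a Sa eq →
      <⇒≱ y< (≤-trans (ℕ./-monoˡ-≤ 16 (^-monoʳ-≤ 2 κ′≤κ)) (subst (_ ≤_) eq (large a Sa))))
    row : ∀ a → ∑ᶠ (λ b → 𝟙 (S b) * adj a (π b)) ≤ deg image (j κ′) (x a) + 1
    row a = begin
      ∑ᶠ (λ b → 𝟙 (S b) * adj a (π b))
        ≤⟨ ∑-mono (allFin n) (λ b → *-monoʳ-≤ (𝟙 (S b)) (any≤∑ (toℕ (π b) ≡ᵇ_) (x a))) ⟩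
      ∑ᶠ (λ b → 𝟙 (S b) * ∑ (x a) (λ y → 𝟙 (toℕ (π b) ≡ᵇ y)))
        ≡⟨ ∑-cong (allFin n) (λ b → sym (∑-*ˡ (x a) (𝟙 (S b)) _)) ⟩
      ∑ᶠ (λ b → ∑ (x a) (λ y → 𝟙 (S b) * 𝟙 (toℕ (π b) ≡ᵇ y)))
        ≡⟨ ∑-swap (allFin n) (x a) _ ⟩
      ∑ (x a) hits
        ≡⟨ trans (cong (λ ys → ∑ ys hits) (sym (take++drop≡id (j κ′) (x a)))) (∑-++ (take (j κ′) (x a)) _ hits) ⟩
      ∑ (take (j κ′) (x a)) hits + ∑ (drop (j κ′) (x a)) hits
        ≤⟨ +-mono-≤ (≤-reflexive (∑-cong (take (j κ′) (x a)) (λ y → sym (at-image y))))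
                    (∑-drop≤1 hits hits≤1 (j κ′) (x a) (All.map missed (tail κ′ κ′≤p a))) ⟩
      deg image (j κ′) (x a) + 1 ∎

  module Matching (M : EdgeSet n) (matching : IsMatching G M) where

    S : Fin n → Bool
    S a = does (nonempty? (M a))

    π : Fin n → Fin n
    π a with nonempty? (M a)
    ... | yes (b , _) = b
    -- An arbitrary default: `π` matters only where `S` holds.
    ... | no  _       = a

    π∈M : ∀ a → S a ≡ true → π a Subset.∈ M a
    π∈M a Sa with nonempty? (M a)
    ... | yes (b , b∈) = b∈

    M-functional : ∀ {a b b′} → b Subset.∈ M a → b′ Subset.∈ M a → b ≡ b′
    M-functional {a} {b} {b′} b∈ b′∈ with b ≟ b′
    ... | yes b≡b′ = b≡b′
    ... | no  b≢b′ = contradiction (inj₁ refl) (proj₂ matching (a , b) (a , b′) b∈ b′∈ (b≢b′ ∘ cong proj₂))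

    π-injective : InjectiveOn S π
    π-injective a a′ Sa Sa′ eq with a ≟ a′
    ... | yes a≡a′ = a≡a′
    ... | no  a≢a′ = contradiction (inj₂ eq)
      (proj₂ matching (a , π a) (a′ , π a′) (π∈M a Sa) (π∈M a′ Sa′) (a≢a′ ∘ cong proj₁))

    size≤card : size M ≤ card S
    size≤card = ≤-trans (≤-reflexive (sym (∑ᶠ≡sum (λ a → ∣ M a ∣)))) (∑-mono (allFin n) ∣M∣≤)
      where
      ∣M∣≤ : ∀ a → ∣ M a ∣ ≤ 𝟙 (S a)
      ∣M∣≤ a with nonempty? (M a)
      ... | yes (b , b∈) = ≤-trans (p⊆q⇒∣p∣≤∣q∣ {q = ⁅ b ⁆} (λ b′∈ → subst (Subset._∈ ⁅ b ⁆) (M-functional b∈ b′∈) (x∈⁅x⁆ b)))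
                                   (≤-reflexive (∣⁅x⁆∣≡1 b))
      ... | no  empty    = ≤-trans (p⊆q⇒∣p∣≤∣q∣ {q = Subset.⊥} (λ b∈ → contradiction (_ , b∈) empty))
                                   (≤-reflexive (∣⊥∣≡0 n))

    loop : ∀ a → S a ≡ true → adj a (π a) ≡ 1
    loop a Sa = ∈G⇒adj (proj₁ matching a (π∈M a Sa))

    -- Dropping the edges with right end below `θ` loses at most `θ` of them because `π` is
    -- injective, and every subset of the remainder satisfies `edges≤` with the same `κ`.
    largeIndependentSet : 1 ≤ size M →
      ∃[ I ] I ⊆ᵇ S × Independent (λ a b → adj a (π b)) I × size M ≤ 20 * card I
    largeIndependentSet 1≤size
      with κ , card≤2^κ , 2^κ< ← log₂-⌈⌉ (card S) (≤-trans 1≤size size≤card) =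
      conclude (independentSet (λ a b → adj a (π b)) 8 (card S₀) S₀ ≤-refl
        (λ a S₀a → ≤-reflexive (sym (loop a (S₀⊆S a S₀a))))
        (λ T T⊆S₀ → edges≤ κ T π (λ a b Ta Tb → π-injective a b (S₀⊆S a (T⊆S₀ a Ta)) (S₀⊆S b (T⊆S₀ b Tb)))
          (λ a Ta → large a (T⊆S₀ a Ta)) (≤-trans (card-mono (λ a Ta → S₀⊆S a (T⊆S₀ a Ta))) card≤2^κ)))
      where
      θ : ℕ
      θ = 2 ^ κ ℕ./ 16

      S₀ : Fin n → Bool
      S₀ a = S a ∧ (θ ≤ᵇ toℕ (π a))

      S₀⊆S : S₀ ⊆ᵇ S
      S₀⊆S a _ with S a
      S₀⊆S a _ | true = refl

      large : ∀ a → S₀ a ≡ true → θ ≤ toℕ (π a)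
      large a S₀a with S a
      ... | true = ≤ᵇ⇒≤ θ (toℕ (π a)) (subst T (sym S₀a) _)

      card-S≤ : card S ≤ card S₀ + θ
      card-S≤ = begin
        card S
          ≤⟨ ∑-mono (allFin n) (λ a → split (S a) θ (toℕ (π a))) ⟩
        ∑ᶠ (λ a → 𝟙 (S₀ a) + 𝟙 (S a) * 𝟙 (toℕ (π a) <ᵇ θ))
          ≡⟨ ∑-+ (allFin n) _ _ ⟩
        card S₀ + ∑ᶠ (λ a → 𝟙 (S a) * 𝟙 (toℕ (π a) <ᵇ θ))
          ≤⟨ +-monoʳ-≤ (card S₀) (≤-trans (∑ᶠ-injective S π π-injective (λ b → 𝟙 (toℕ b <ᵇ θ))) (∑ᶠ-<ᵇ n θ)) ⟩
        card S₀ + θ ∎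
        where
        open ≤-Reasoning
        <ᵇ-total : ∀ m y → 1 ≤ 𝟙 (m <ᵇ y) + (𝟙 (y <ᵇ suc m) + 0)
        <ᵇ-total zero    zero    = ≤-refl
        <ᵇ-total zero    (suc y) = s≤s z≤n
        <ᵇ-total (suc m) zero    = ≤-refl
        <ᵇ-total (suc m) (suc y) = <ᵇ-total m y
        split : ∀ s θ y → 𝟙 s ≤ 𝟙 (s ∧ (θ ≤ᵇ y)) + 𝟙 s * 𝟙 (y <ᵇ θ)
        split false θ       y = z≤n
        split true  zero    y = s≤s z≤n
        split true  (suc m) y = <ᵇ-total m y

      conclude : ∃[ I ] I ⊆ᵇ S₀ × Independent (λ a b → adj a (π b)) I × card S₀ ≤ 2 * 8 * card I →
        ∃[ I ] I ⊆ᵇ S × Independent (λ a b → adj a (π b)) I × size M ≤ 20 * card I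
      conclude (I , I⊆S₀ , indep , card-S₀≤) =
        I , (λ a → S₀⊆S a ∘ I⊆S₀ a) , indep , ≤-trans size≤card
          (s≤20i {card S} {card I} {θ} (≤-trans card-S≤ (+-monoˡ-≤ θ card-S₀≤))
            (8θ≤s {card S} {θ} {κ} (ℕ.m/n*n≤m (2 ^ κ) 16) 2^κ<))

    -- An edge of `G` connecting two chosen edges joins the left end of one to the partner of the
    -- other, which independence forbids in both orders.
    inducedMatching :
      ∃[ I ] I ⊆ᵇ S × Independent (λ a b → adj a (π b)) I × size M ≤ 20 * card I →
      Σ[ M′ ∈ EdgeSet n ] M′ ⊆ᴱ M × IsInducedMatching G M′ × size M ≤ 20 * size M′
    inducedMatching (I , I⊆S , indep , size≤) =
      M′ , M′⊆M , (((λ a → proj₁ matching a ∘ M′⊆M a) , disjoint) , induced)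
         , subst (λ m → size M ≤ 20 * m) (sym size-M′) size≤
      where
      M′ : EdgeSet n
      M′ a = if I a then ⁅ π a ⁆ else Subset.⊥

      ∈M′⁻ : ∀ {a b} → b Subset.∈ M′ a → I a ≡ true × b ≡ π a
      ∈M′⁻ {a} b∈ with I a
      ... | true  = refl , x∈⁅y⁆⇒x≡y (π a) b∈
      ... | false = contradiction b∈ ∉⊥

      M′⊆M : M′ ⊆ᴱ M
      M′⊆M a b∈ with Ia , refl ← ∈M′⁻ {a} b∈ = π∈M a (I⊆S a Ia)

      disjoint : ∀ e f → e ∈ᴱ M′ → f ∈ᴱ M′ → e ≢ f → ¬ ShareVertex e f
      disjoint e f e∈ f∈ = proj₂ matching e f (M′⊆M _ e∈) (M′⊆M _ f∈)

      nonadjacent : ∀ {a b} → I a ≡ true → I b ≡ true → a ≢ b → ¬ π b Subset.∈ G a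
      nonadjacent {a} {b} Ia Ib a≢b πb∈ with () ← trans (sym (∈G⇒adj πb∈)) (indep a b Ia Ib a≢b)

      induced : ∀ e f → e ∈ᴱ M′ → f ∈ᴱ M′ → e ≢ f → ¬ Connected G e f
      induced (a , b) (a′ , b′) e∈ f∈ e≢f connected
        with Ia , refl ← ∈M′⁻ {a} e∈ | Ia′ , refl ← ∈M′⁻ {a′} f∈ | connected
      ... | inj₁ πa′∈ = nonadjacent Ia Ia′ (λ { refl → e≢f refl }) πa′∈
      ... | inj₂ πa∈  = nonadjacent Ia′ Ia (λ { refl → e≢f refl }) πa∈

      size-M′ : size M′ ≡ card I
      size-M′ = trans (sym (∑ᶠ≡sum (λ a → ∣ M′ a ∣))) (∑-cong (allFin n) (λ a → ∣if∣ (I a) a))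
        where
        ∣if∣ : ∀ b a → ∣ (if b then ⁅ π a ⁆ else Subset.⊥) ∣ ≡ 𝟙 b
        ∣if∣ true  a = ∣⁅x⁆∣≡1 (π a)
        ∣if∣ false a = ∣⊥∣≡0 n

-- Parameters of the levels

∑ᶠ-≡ᵇ : ∀ {y} → y < n → ∑ᶠ {n} (λ b → 𝟙 (toℕ b ≡ᵇ y)) ≡ 1
∑ᶠ-≡ᵇ {n} {y} y<n = trans (∑-cong (allFin n) eq) (∑ᶠ-δ₁ (fromℕ< y<n))
  where
  ≡ᵇ-sym : ∀ a b → (a ≡ᵇ b) ≡ (b ≡ᵇ a)
  ≡ᵇ-sym zero    zero    = refl
  ≡ᵇ-sym zero    (suc b) = refl
  ≡ᵇ-sym (suc a) zero    = refl
  ≡ᵇ-sym (suc a) (suc b) = ≡ᵇ-sym a b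
  eq : ∀ b → 𝟙 (toℕ b ≡ᵇ y) ≡ δ (fromℕ< y<n) b
  eq b = trans (cong 𝟙 (≡ᵇ-sym (toℕ b) y))
    (trans (cong (λ z → 𝟙 (z ≡ᵇ toℕ b)) (sym (toℕ-fromℕ< y<n))) (sym (δ≡≡ᵇ (fromℕ< y<n) b)))

length≤∣graph∣ : (x : Fin n → List ℕ) → ∀ a → All (_< n) (x a) → AllPairs _≢_ (x a) → length (x a) ≤ ∣ graph x a ∣
length≤∣graph∣ {n} x a bounded distinct =
  ≤-trans (count (x a) bounded distinct) (≤-reflexive (sym (∣tabulate∣ {n} (λ b → any (toℕ b ≡ᵇ_) (x a)))))
  where
  open ≤-Reasoning
  absent : ∀ {y} ys → All (y ≢_) ys → any (y ≡ᵇ_) ys ≡ false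
  absent []       []         = refl
  absent (z ∷ ys) (y≢z ∷ y≢ys) rewrite ≢⇒≡ᵇ y≢z = absent ys y≢ys
  count : ∀ ys → All (_< n) ys → AllPairs _≢_ ys → length ys ≤ ∑ᶠ {n} (λ b → 𝟙 (any (toℕ b ≡ᵇ_) ys))
  count []       _            _               = z≤n
  count (y ∷ ys) (y<n ∷ ys<n) (y≢ys ∷ distinct) = begin
    1 + length ys
      ≤⟨ +-mono-≤ (≤-reflexive (sym (∑ᶠ-≡ᵇ y<n))) (count ys ys<n distinct) ⟩
    ∑ᶠ {n} (λ b → 𝟙 (toℕ b ≡ᵇ y)) + ∑ᶠ {n} (λ b → 𝟙 (any (toℕ b ≡ᵇ_) ys))
      ≡⟨ ∑-+ (allFin n) _ _ ⟨
    ∑ᶠ {n} (λ b → 𝟙 (toℕ b ≡ᵇ y) + 𝟙 (any (toℕ b ≡ᵇ_) ys))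
      ≤⟨ ∑-mono (allFin n) (λ b → le (toℕ b)) ⟩
    ∑ᶠ {n} (λ b → 𝟙 (any (toℕ b ≡ᵇ_) (y ∷ ys))) ∎
    where
    le : ∀ b → 𝟙 (b ≡ᵇ y) + 𝟙 (any (b ≡ᵇ_) ys) ≤ 𝟙 (any (b ≡ᵇ_) (y ∷ ys))
    le b with b ≡ᵇ y in eq
    ... | false = ≤-refl
    ... | true rewrite ≡ᵇ-sound b y eq | absent ys y≢ys = ≤-refl

all-take : ∀ {P : A → Set} f t j → (∀ {i} → i < j → P (f i)) → All P (take j (applyUpTo f t))
all-take f t       zero    Pf = []
all-take f zero    (suc j) Pf = []
all-take f (suc t) (suc j) Pf = Pf z<s ∷ all-take (f ∘ suc) t j (Pf ∘ s<s)

all-drop : ∀ {P : A → Set} f t j → (∀ {i} → j ≤ i → i < t → P (f i)) → All P (drop j (applyUpTo f t))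
all-drop f t       zero    Pf = All.applyUpTo⁺₁ f t (Pf z≤n)
all-drop f zero    (suc j) Pf = []
all-drop f (suc t) (suc j) Pf = all-drop (f ∘ suc) t j (λ j≤i i<t → Pf (s≤s j≤i) (s≤s i<t))

pointwise-drop : ∀ {R : A → X → Set} {P : A → Set} {Q : X → Set} → (∀ {r y} → P r → R r y → Q y) →
                 ∀ {rs ys} k → Pointwise R rs ys → All P (drop k rs) → All Q (drop k ys)
pointwise-drop f zero    []         []         = []
pointwise-drop f zero    (Rxy ∷ Rs) (Px ∷ Ps)  = f Px Rxy ∷ pointwise-drop f zero Rs Ps
pointwise-drop f (suc k) []         _          = []
pointwise-drop f (suc k) (_ ∷ Rs)   Ps         = pointwise-drop f k Rs Ps

∈ᴸ-distinct : ∀ {rs ys} → Pointwise (λ r y → y ∈ᴸ r) rs ys → AllPairs _>_ rs → AllPairs _≢_ ys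
∈ᴸ-distinct []                 []             = []
∈ᴸ-distinct {r ∷ _} {y ∷ _} (y∈r ∷ ys∈rs) (r>rs ∷ desc) =
  pointwise-drop apart 0 ys∈rs r>rs ∷ ∈ᴸ-distinct ys∈rs desc
  where
  apart : ∀ {r′ y′} → r > r′ → y′ ∈ᴸ r′ → y ≢ y′
  apart r′<r y′∈r′ refl = <⇒≱ (proj₂ y′∈r′) (≤-trans (^-monoʳ-≤ 2 r′<r) (proj₁ y∈r))

-- The number of levels to which the union bound applies for sets of size about 2 ^ (p ∸ q).
cutoff : ∀ t q → ∃[ j ] j ≤ t × (j ≡ 0 ⊎ 2 * 16 ^ j ≤ q) × (j < t → q < 2 * 16 ^ suc j)
cutoff zero    q = 0 , z≤n , inj₁ refl , λ ()
cutoff (suc t) q with 2 * 16 ^ suc t ≤? q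
... | yes le = suc t , ≤-refl , inj₂ le , λ lt → contradiction lt (<-irrefl refl)
... | no  ≰q with cutoff t q
...   | j , j≤t , small , large = j , m≤n⇒m≤1+n j≤t , small , λ _ → [ large , (λ { refl → ≰⇒> ≰q }) ] (m≤n⇒m<n∨m≡n j≤t)

-- Existence of suitable choices

record Choices (n p t : ℕ) : Set where
  field
    x        : Fin n → List ℕ
    j        : ℕ → ℕ
    bounded  : ∀ a → All (_< n) (x a)
    distinct : ∀ a → AllPairs _≢_ (x a)
    long     : ∀ a → t ≤ length (x a)
    sparse   : ∀ κ → κ ≤ p → (S χ : Subset n) → ∣ S ∣ ≡ ∣ χ ∣ → ∣ S ∣ ≤ 2 ^ κ → 2 ^ κ < 2 * ∣ S ∣ →
               ∑ᶠ (λ a → 𝟙 (lookup S a) * deg χ (j κ) (x a)) ≤ 7 * ∣ S ∣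
    tail     : ∀ κ → κ ≤ p → ∀ a → All (λ y → y < 2 ^ κ ℕ./ 16) (drop (suc (j κ)) (x a))

perfectMatchingChoices : ∀ n p t → t ≤ 1 → Choices n p t
perfectMatchingChoices n p t t≤1 = record
  { x        = λ a → toℕ a ∷ []
  -- The only level then lies in the prefix, where it gives at most one edge per vertex, and the
  -- tail is empty.
  ; j        = λ _ → 1
  ; bounded  = λ a → toℕ<n a ∷ []
  ; distinct = λ a → [] ∷ []
  ; long     = λ a → t≤1
  ; sparse   = λ κ κ≤p S χ ∣S∣≡∣χ∣ ∣S∣≤ 2^κ< → begin
      ∑ᶠ (λ a → 𝟙 (lookup S a) * (at χ (toℕ a) + 0))
        ≤⟨ ∑-mono (allFin n) (λ a → *-monoʳ-≤ (𝟙 (lookup S a)) (≤-trans (≤-reflexive (+-identityʳ _)) (at≤1 χ (toℕ a)))) ⟩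
      ∑ᶠ (λ a → 𝟙 (lookup S a) * 1)
        ≡⟨ ∑-cong (allFin n) (λ a → *-identityʳ (𝟙 (lookup S a))) ⟩
      ∑ᶠ (𝟙 ∘ lookup S)
        ≡⟨ ∣∣≡∑ᶠ S ⟨
      ∣ S ∣
        ≤⟨ m≤m+n ∣ S ∣ (6 * ∣ S ∣) ⟩
      7 * ∣ S ∣ ∎
  ; tail     = λ κ κ≤p a → []
  }
  where open ≤-Reasoning

-- `16^i<p` makes every subtraction in the exponents `r i` with `i < t` genuine, so that they
-- strictly decrease.
module RandomLevels
  (n p t : ℕ) (n≤2^p : n ≤ 2 ^ p) (2^p<2n : 2 ^ p < 2 * n) (16^i<p : ∀ i → i ≤ t → 16 ^ i < p) where

  open ≤-Reasoning

  r : ℕ → ℕ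
  r i = p ∸ 16 ^ suc i

  rs : List ℕ
  rs = applyUpTo r t

  -- For positive `j κ`, the smallest of the first `j κ` exponents is `p ∸ 16 ^ j κ`, and `ℓ κ` is
  -- the largest value that `κ+ℓ≤r` then allows.
  j ℓ : ℕ → ℕ
  j κ = proj₁ (cutoff t (p ∸ κ))
  ℓ κ = p ∸ κ ∸ 16 ^ j κ

  j≤t : ∀ κ → j κ ≤ t
  j≤t κ = proj₁ (proj₂ (cutoff t (p ∸ κ)))

  below : ∀ κ → j κ ≡ 0 ⊎ 2 * 16 ^ j κ ≤ p ∸ κ
  below κ = proj₁ (proj₂ (proj₂ (cutoff t (p ∸ κ))))

  beyond : ∀ κ → j κ < t → p ∸ κ < 2 * 16 ^ suc (j κ)
  beyond κ = proj₂ (proj₂ (proj₂ (cutoff t (p ∸ κ))))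

  κ+ℓ≤r : ∀ κ → κ ≤ p → All (κ + ℓ κ ≤_) (take (j κ) rs)
  κ+ℓ≤r κ κ≤p = all-take r t (j κ) le
    where
    le : ∀ {i} → i < j κ → κ + ℓ κ ≤ r i
    le {i} i<j with below κ
    ... | inj₁ j≡0  = contradiction (subst (i <_) j≡0 i<j) (λ ())
    ... | inj₂ 2·16^j≤q = begin
      κ + (p ∸ κ ∸ 16 ^ j κ)   ≡⟨ +-∸-assoc κ (≤-trans (m≤m+n (16 ^ j κ) _) 2·16^j≤q) ⟨
      κ + (p ∸ κ) ∸ 16 ^ j κ   ≡⟨ cong (_∸ 16 ^ j κ) (m+[n∸m]≡n κ≤p) ⟩
      p ∸ 16 ^ j κ             ≤⟨ ∸-monoʳ-≤ p (^-monoʳ-≤ 16 i<j) ⟩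
      p ∸ 16 ^ suc i           ∎

  j+9≤16^j : ∀ j → suc j + 9 ≤ 16 ^ suc j
  j+9≤16^j zero    = m≤m+n 10 6
  j+9≤16^j (suc j) = begin
    1 + (suc j + 9)          ≤⟨ +-mono-≤ (m^n>0 16 (suc j)) (j+9≤16^j j) ⟩
    16 ^ suc j + 16 ^ suc j  ≡⟨ cong (16 ^ suc j +_) (+-identityʳ _) ⟨
    2 * 16 ^ suc j           ≤⟨ *-monoˡ-≤ (16 ^ suc j) (m≤m+n 2 14) ⟩
    16 * 16 ^ suc j          ∎

  -- With `E = 16 ^ j κ` and `p ∸ κ = 2 * E + d`, the left side is at most `7 * E + 3 * d`, while
  -- `ℓ κ = E + d`.
  ℓ-large : ∀ κ → κ ≤ p → j κ ≡ 0 ⊎ 3 * (p ∸ κ) + j κ + 9 ≤ 7 * ℓ κ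
  ℓ-large κ κ≤p with j κ | below κ
  ... | zero  | _                = inj₁ refl
  ... | suc i | inj₂ 2·16^j≤q with d , eq ← m≤n⇒∃[o]m+o≡n 2·16^j≤q = inj₂ (begin
    3 * (p ∸ κ) + suc i + 9             ≡⟨ +-assoc (3 * (p ∸ κ)) (suc i) 9 ⟩
    3 * (p ∸ κ) + (suc i + 9)           ≤⟨ +-monoʳ-≤ (3 * (p ∸ κ)) (j+9≤16^j i) ⟩
    3 * (p ∸ κ) + E                     ≡⟨ cong (λ q → 3 * q + E) eq ⟨
    3 * (2 * E + d) + E                 ≡⟨ regroup E d ⟩
    7 * E + 3 * d                       ≤⟨ +-monoʳ-≤ (7 * E) (*-monoˡ-≤ d (m≤m+n 3 4)) ⟩
    7 * E + 7 * d                       ≡⟨ *-distribˡ-+ 7 E d ⟨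
    7 * (E + d)                         ≡⟨ cong (7 *_) (trans (sym (m+n∸m≡n E (E + d))) (cong (_∸ E) (shuffle E d))) ⟩
    7 * (2 * E + d ∸ E)                 ≡⟨ cong (λ q → 7 * (q ∸ E)) eq ⟩
    7 * (p ∸ κ ∸ E)                     ∎)
    where
    E : ℕ
    E = 16 ^ suc i
    regroup : ∀ E d → 3 * (2 * E + d) + E ≡ 7 * E + 3 * d
    regroup = solve-∀
    shuffle : ∀ E d → E + (E + d) ≡ 2 * E + d
    shuffle = solve-∀

  -- `16 ^ suc i` is at least `16 * E`, while `p ∸ κ` is less than `2 * E`; the remaining `14 * E`
  -- absorbs the 5.
  r+5≤κ : ∀ κ → κ ≤ p → ∀ {i} → suc (j κ) ≤ i → i < t → r i + 5 ≤ κ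
  r+5≤κ κ κ≤p {i} j<i i<t = +-cancelʳ-≤ (p ∸ κ) _ _ (begin
    r i + 5 + (p ∸ κ)           ≡⟨ +-assoc (r i) 5 (p ∸ κ) ⟩
    r i + (5 + (p ∸ κ))         ≤⟨ +-monoʳ-≤ (r i) (+-mono-≤ five (<⇒≤ (beyond κ (<-trans j<i i<t)))) ⟩
    r i + (14 * E + 2 * E)      ≡⟨ cong (r i +_) (*-distribʳ-+ E 14 2) ⟨
    r i + 16 * E                ≤⟨ +-monoʳ-≤ (r i) (^-monoʳ-≤ 16 (s≤s j<i)) ⟩
    r i + 16 ^ suc i            ≡⟨ m∸n+n≡m (<⇒≤ (16^i<p (suc i) i<t)) ⟩
    p                           ≡⟨ m+[n∸m]≡n κ≤p ⟨
    κ + (p ∸ κ)                 ∎)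
    where
    E : ℕ
    E = 16 ^ suc (j κ)
    five : 5 ≤ 14 * E
    five = ≤-trans (m≤m+n 5 9) (*-monoʳ-≤ 14 (m^n>0 16 (suc (j κ))))

  -- Of the 5, one accounts for the upper end `2 ^ suc r` of the level and four for the division by
  -- 16.
  below-θ : ∀ {κ r y} → r + 5 ≤ κ → y ∈ᴸ r → y < 2 ^ κ ℕ./ 16
  below-θ {κ} {r} {y} r+5≤κ (_ , y<) = begin-strict
    y                        <⟨ y< ⟩
    2 ^ suc r                ≡⟨ ℕ.m*n/n≡m (2 ^ suc r) 16 ⟨
    2 ^ suc r * 2 ^ 4 ℕ./ 16 ≡⟨ cong (ℕ._/ 16) (^-distribˡ-+-* 2 (suc r) 4) ⟨
    2 ^ (suc r + 4) ℕ./ 16   ≤⟨ ℕ./-monoˡ-≤ 16 (^-monoʳ-≤ 2 (subst (_≤ κ) (+-suc r 4) r+5≤κ)) ⟩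
    2 ^ κ ℕ./ 16             ∎

  -- The strict inequality puts the level below `2 ^ (p ∸ 1)`, hence below `n`, as `2 ^ p < 2 * n`.
  suc-r<p : ∀ {i} → i < t → suc (r i) < p
  suc-r<p {i} i<t = begin-strict
    suc (p ∸ 16 ^ suc i)          <⟨ +-monoˡ-≤ (p ∸ 16 ^ suc i) (≤-trans (m≤m+n 2 14) (*-monoʳ-≤ 16 (m^n>0 16 i))) ⟩
    16 ^ suc i + (p ∸ 16 ^ suc i) ≡⟨ m+[n∸m]≡n (<⇒≤ (16^i<p (suc i) i<t)) ⟩
    p                             ∎

  below-n : ∀ {r y} → suc r < p → y ∈ᴸ r → y < n
  below-n {r} {y} r<p (_ , y<) = *-cancelˡ-< 2 y n (begin-strict
    2 * y            <⟨ *-monoʳ-< 2 y< ⟩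
    2 ^ suc (suc r)  ≤⟨ ^-monoʳ-≤ 2 r<p ⟩
    2 ^ p            <⟨ 2^p<2n ⟩
    2 * n            ∎)

  descending : AllPairs _>_ rs
  descending = AllPairs.applyUpTo⁺₁ r t
    (λ {i} {i′} i<i′ i′<t → ∸-monoʳ-< (^-monoʳ-< 16 (s≤s (s≤s z≤n)) (s≤s i<i′)) (<⇒≤ (16^i<p (suc i′) i′<t)))

  choicesExist : Choices n p t
  choicesExist =
    let v , v∈ , sparse = UnionBound.sparseChoices {t = t} rs j ℓ n≤2^p (λ κ _ → j≤t κ) κ+ℓ≤r ℓ-large
        ∈levels : ∀ a → Pointwise (λ r y → y ∈ᴸ r) rs (lookup v a)
        ∈levels a = ∈-choices⁻ rs (VecAll.lookup⁺ v∈ a)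
    in record
      { x        = lookup v
      ; j        = j
      ; bounded  = λ a → pointwise-drop {P = λ r → suc r < p} (λ {r} → below-n {r}) 0 (∈levels a)
                     (All.applyUpTo⁺₁ r t suc-r<p)
      ; distinct = λ a → ∈ᴸ-distinct (∈levels a) descending
      ; long     = λ a → ≤-reflexive (trans (sym (length-applyUpTo r t)) (Pointwise.Pointwise-length (∈levels a)))
      ; sparse   = λ κ κ≤p S χ ∣S∣≡∣χ∣ ∣S∣≤ 2^κ< →
          subst (_≤ 7 * ∣ S ∣) (∑ˢ≡∑ᶠ (deg χ (j κ)) S v) (sparse κ κ≤p S χ ∣S∣≡∣χ∣ ∣S∣≤ 2^κ<)
      ; tail     = λ κ κ≤p a → pointwise-drop {P = λ r → r + 5 ≤ κ} (λ {r} → below-θ {κ} {r}) (suc (j κ)) (∈levels a)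
                     (all-drop r t (suc (j κ)) (r+5≤κ κ κ≤p))
      }

-- `256 ^ (t ∸ 1)` is `16 ^ (2 * (t ∸ 1))`, and `2 * (t ∸ 1)` is at least `t` once `t` is at least
-- 2, so all levels fit. For `t = 1` only `1 < p` is known, hence the perfect matching.
choicesOfLength : ∀ n p t → n ≤ 2 ^ p → 2 ^ p < 2 * n → (t ≡ 0 ⊎ ∃[ t′ ] t ≡ suc t′ × 256 ^ t′ < p) → Choices n p t
choicesOfLength n p t n≤2^p 2^p<2n (inj₁ refl)                   = perfectMatchingChoices n p 0 z≤n
choicesOfLength n p t n≤2^p 2^p<2n (inj₂ (zero , refl , _))       = perfectMatchingChoices n p 1 ≤-refl
choicesOfLength n p t n≤2^p 2^p<2n (inj₂ (suc t′ , refl , 256^<p)) =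
  RandomLevels.choicesExist n p t n≤2^p 2^p<2n λ i i≤t → begin-strict
    16 ^ i                 ≤⟨ ^-monoʳ-≤ 16 (≤-trans i≤t (s≤s (m≤n+m (suc t′) t′))) ⟩
    16 ^ (suc t′ + suc t′) ≡⟨ cong (λ k → 16 ^ (suc t′ + k)) (+-identityʳ (suc t′)) ⟨
    16 ^ (2 * suc t′)      ≡⟨ ^-*-assoc 16 2 (suc t′) ⟨
    256 ^ suc t′           <⟨ 256^<p ⟩
    p                      ∎
  where open ≤-Reasoning

-- Rational bounds and logarithms

open import Data.Integer.Base using (+_)

fromℕ : ℕ → ℚᵘ
fromℕ m = + m / 1

fromℕ-mono : ∀ {m n} → m ≤ n → fromℕ m ℚ.≤ fromℕ n
fromℕ-mono m≤n = *≤* (ℤ.*-monoʳ-≤-nonNeg (+ 1) (+≤+ m≤n))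

fromℕ-cancel-< : ∀ {m n} → fromℕ m ℚ.< fromℕ n → m < n
fromℕ-cancel-< {m} {n} (*<* lt) = ℤ.drop‿+<+ (subst₂ ℤ._<_ (ℤ.*-identityʳ (+ m)) (ℤ.*-identityʳ (+ n)) lt)

fromℕ-* : ∀ m n → fromℕ m ℚ.* fromℕ n ≡ fromℕ (m * n)
fromℕ-* m n = cong (λ i → mkℚᵘ i 0) (sym (ℤ.pos-* m n))

^ℚ-nonNegative : ∀ {s} → 0ℚᵘ ℚ.≤ s → ∀ k → 0ℚᵘ ℚ.≤ s ^ℚ k
^ℚ-nonNegative 0≤s zero    = fromℕ-mono {0} {1} z≤n
^ℚ-nonNegative {s} 0≤s (suc k) = ℚ.≤-trans (ℚ.≤-reflexive (ℚ.≃-sym (ℚ.*-zeroˡ 0ℚᵘ)))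
  (ℚ.*-mono-≤-nonNeg {{ℚ.nonNegative ℚ.≤-refl}} {{ℚ.nonNegative ℚ.≤-refl}} 0≤s (^ℚ-nonNegative 0≤s k))

^ℚ-≤-fromℕ : ∀ {s m} → 0ℚᵘ ℚ.≤ s → s ℚ.≤ fromℕ m → ∀ k → s ^ℚ k ℚ.≤ fromℕ (m ^ k)
^ℚ-≤-fromℕ 0≤s s≤m zero    = ℚ.≤-refl
^ℚ-≤-fromℕ {s} {m} 0≤s s≤m (suc k) = subst (s ^ℚ suc k ℚ.≤_) (fromℕ-* m (m ^ k))
  (ℚ.*-mono-≤-nonNeg {{ℚ.nonNegative 0≤s}} {{ℚ.nonNegative (^ℚ-nonNegative 0≤s k)}} s≤m (^ℚ-≤-fromℕ 0≤s s≤m k))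

-- For `q = a / b` with `a` nonnegative, `2 ^ a < s ^ b ≤ 2 ^ (m * b)` gives `a < m * b`; a negative
-- `q` is below `m` anyway.
Exp₂<⇒≤ : ∀ {q s} m → Exp₂< q s → s ℚ.≤ fromℕ (2 ^ m) → q ℚ.≤ fromℕ m
Exp₂<⇒≤ {mkℚᵘ (-[1+ a ]) d} {s} m _ _ = *≤* (subst (-[1+ a ] ℤ.* + 1 ℤ.≤_) (ℤ.pos-* m (suc d)) -≤+)
Exp₂<⇒≤ {mkℚᵘ (+ a) d} {s} m (0<s , 2^a<s^d) s≤2^m = *≤* (subst₂ ℤ._≤_ (sym (ℤ.*-identityʳ (+ a))) (ℤ.pos-* m (suc d))
  (+≤+ (<⇒≤ (2^-cancel-< (fromℕ-cancel-< (ℚ.<-≤-trans 2^a<s^d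
    (subst (λ k → s ^ℚ suc d ℚ.≤ fromℕ k) (^-*-assoc 2 m (suc d)) (^ℚ-≤-fromℕ (ℚ.<⇒≤ 0<s) s≤2^m (suc d)))))))))

-- `256 ^ t` is `2 ^ (8 * t)`, so the two logarithms are at most `p` and `8 * t`, and the factor 1/8
-- leaves `t`.
log₂log₂≤ : ∀ {n p t} → n ≤ 2 ^ p → p ≤ 256 ^ t → (+ 1 / 8) · log₂ (log₂ (natural n)) ≤ᶜ fromℕ t
log₂log₂≤ {n} {p} {t} n≤2^p p≤256^t q (r , (s , (s′ , s′<n , exp-s) , exp-r) , q≤r/8) =
  ℚ.≤-trans q≤r/8 (ℚ.≤-trans (ℚ.*-monoʳ-≤-nonNeg (+ 1 / 8) r≤8t) (*≤* (ℤ.≤-reflexive 8t/8)))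
  where
  s≤p : s ℚ.≤ fromℕ p
  s≤p = Exp₂<⇒≤ p exp-s (ℚ.≤-trans (ℚ.<⇒≤ s′<n) (fromℕ-mono n≤2^p))
  r≤8t : r ℚ.≤ fromℕ (8 * t)
  r≤8t = Exp₂<⇒≤ (8 * t) exp-r (ℚ.≤-trans s≤p (fromℕ-mono (subst (p ≤_) (^-*-assoc 2 8 t) p≤256^t)))
  8t/8 : + 1 ℤ.* + (8 * t) ℤ.* + 1 ≡ + t ℤ.* + 8
  8t/8 = trans (ℤ.*-identityʳ _) (trans (ℤ.*-identityˡ _) (trans (ℤ.pos-* 8 t) (ℤ.*-comm (+ 8) (+ t))))

-- Average degree and conclusion

∑leftDegree≡∑rightDegree : (G : BipartiteGraph n) → ∑ᶠ (leftDegree G) ≡ ∑ᶠ (rightDegree G)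
∑leftDegree≡∑rightDegree {n} G = begin
  ∑ᶠ (leftDegree G)
    ≡⟨ ∑-cong (allFin n) (λ a → ∣∣≡∑ᶠ (G a)) ⟩
  ∑ᶠ {n} (λ a → ∑ᶠ {n} (λ b → 𝟙 (lookup (G a) b)))
    ≡⟨ ∑-swap (allFin n) (allFin n) (λ a b → 𝟙 (lookup (G a) b)) ⟩
  ∑ᶠ {n} (λ b → ∑ᶠ {n} (λ a → 𝟙 (lookup (G a) b)))
    ≡⟨ ∑-cong (allFin n) (λ b → sym (∣tabulate∣ {n} (λ a → lookup (G a) b))) ⟩
  ∑ᶠ (rightDegree G) ∎
  where open ≡-Reasoning

≤averageDegree : ∀ {n t} .{{_ : NonZero n}} (G : BipartiteGraph n) →
  (∀ a → t ≤ leftDegree G a) → fromℕ t ℚ.≤ averageDegree G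
≤averageDegree {n@(suc _)} {t} G t≤deg = *≤* (subst₂ ℤ._≤_ (ℤ.pos-* t (2 * n)) (sym (ℤ.*-identityʳ _)) (+≤+ (begin
  t * (2 * n)
    ≡⟨ trans (*-comm t (2 * n)) (trans (*-assoc 2 n t) (cong (λ m → n * t + m) (+-identityʳ (n * t)))) ⟩
  n * t + n * t
    ≤⟨ +-mono-≤ nt≤ nt≤ ⟩
  ∑ᶠ (leftDegree G) + ∑ᶠ (leftDegree G)
    ≡⟨ cong₂ _+_ (∑ᶠ≡sum (leftDegree G)) (trans (∑leftDegree≡∑rightDegree G) (∑ᶠ≡sum (rightDegree G))) ⟩
  _ ∎)))
  where
  open ≤-Reasoning
  nt≤ : n * t ≤ ∑ᶠ (leftDegree G)
  nt≤ = ≤-trans (≤-reflexive (sym (∑ᶠ-const n t))) (∑-mono (allFin n) t≤deg)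

1/20*≤ : ∀ {k m} → k ≤ 20 * m → (+ 1 / 20) ℚ.* fromℕ k ℚ.≤ fromℕ m
1/20*≤ {k} {m} k≤20m = *≤* (subst₂ ℤ._≤_ (sym (trans (ℤ.*-identityʳ _) (ℤ.*-identityˡ (+ k))))
  (trans (ℤ.pos-* 20 m) (ℤ.*-comm (+ 20) (+ m))) (+≤+ k≤20m))

choices⇒multitasker : ∀ {n p t} .{{_ : NonZero n}} → n ≤ 2 ^ p → p ≤ 256 ^ t → Choices n p t →
  Σ[ G ∈ BipartiteGraph n ]
  ((+ 1 / 8) · log₂ (log₂ (natural n)) ≤ᶜ averageDegree G
  × IsMultitasker (+ 1 / 20) G)
choices⇒multitasker {n} {p} {t} n≤2^p p≤256^t choices =
  graph x , average≤ , record
    { 0<α     = *<* (ℤ.+<+ z<s)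
    ; α≤1     = *≤* (+≤+ (m≤m+n 1 19))
    ; induced = λ k 1≤k k≤n M matching size≡k → submatching M matching (subst (1 ≤_) (sym size≡k) 1≤k)
    }
  where
  open Choices choices
  open Multitasking x j n≤2^p sparse tail using (module Matching)
  average≤ : (+ 1 / 8) · log₂ (log₂ (natural n)) ≤ᶜ averageDegree (graph x)
  average≤ q q<x = ℚ.≤-trans (log₂log₂≤ {n} {p} {t} n≤2^p p≤256^t q q<x)
    (≤averageDegree {n} {t} (graph x) (λ a → ≤-trans (long a) (length≤∣graph∣ x a (bounded a) (distinct a))))
  submatching : ∀ M → IsMatching (graph x) M → 1 ≤ size M → Σ[ M′ ∈ EdgeSet n ]
    M′ ⊆ᴱ M × IsInducedMatching (graph x) M′ × (+ 1 / 20) ℚ.* fromℕ (size M) ℚ.≤ fromℕ (size M′)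
  submatching M matching 1≤size =
    let M′ , M′⊆M , induced , size≤ = Matching.inducedMatching M matching
          (Matching.largeIndependentSet M matching 1≤size)
    in M′ , M′⊆M , induced , 1/20*≤ {size M} {size M′} size≤

theorem4p13 : ∀ (n : ℕ) .{{_ : NonZero n}} → 2 ≤ n →
    Σ[ G ∈ BipartiteGraph n ]
    ((+ 1 / 8) · log₂ (log₂ (natural n)) ≤ᶜ averageDegree G
    × IsMultitasker (+ 1 / 20) G)
theorem4p13 n 2≤n =
  let p , n≤2^p , 2^p<2n = log₂-⌈⌉ n (≤-trans (s≤s z≤n) 2≤n)
      -- The search for the least `t` can start at `p` because `p ≤ 256 ^ p`; minimality is what
      -- makes `t` levels fit below `p`.
      t , p≤256^t , least = log-⌈⌉ 256 p p (1≤p n≤2^p)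
        (≤-trans (<⇒≤ (n<2^n p)) (^-monoˡ-≤ p (m≤m+n 2 254)))
  in choices⇒multitasker {n} {p} {t} n≤2^p p≤256^t (choicesOfLength n p t n≤2^p 2^p<2n least)
  where
  1≤p : ∀ {p} → n ≤ 2 ^ p → 1 ≤ p
  1≤p {zero}  n≤1 = s≤s⁻¹ (≤-trans 2≤n n≤1)
  1≤p {suc p} _   = s≤s z≤n
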